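{- Let $X$ be a $d$-dimensional $\epsilon$-colorful expander, $d>1$. Then all of the high order random walks on $X$ (on every dimension $0 \le i < d$) are $\mu$-rapidly mixing for $$\mu = 1 - \frac{\epsilon^2}{2(d+1)^2}.$$
   Context: $X$ is a pure $d$-dimensional simplicial complex; $X(i)$ denotes its $i$-faces, and the degree $\deg(\sigma)$ of a face is the number of $d$-faces containing it. For an $i$-cochain (subset) $W \subseteq X(i)$, its norm is $\|W\| = \sum_{\sigma \in W}\deg(\sigma) / \sum_{\tau \in X(i)}\deg(\tau)$. The expanding faces of $W$ are $\psi(W) = \{\tau \in X(i+1) \mid \exists\, \sigma,\sigma' \subset \tau: \sigma \in W,\ \sigma' \in X(i)\setminus W\}$. $X$ is an $\epsilon$-colorful expander ($\epsilon>0$) if for every $0 \le i < d$ and every $W \subseteq X(i)$ with $0 < \|W\| \le 1/2$ we have $\|\psi(W)\|/\|W\| \ge \epsilon$. The high order random walk on dimension $i$ ($0 \le i < d$): two $i$-faces $\sigma,\sigma'$ are neighbors ($\sigma\sim\sigma'$) if $\sigma\cup\sigma' \in X(i+1)$; from $\sigma_t$ one moves to a neighbor $\sigma'$ with probability $\deg(\sigma_t\cup\sigma')/\sum_{\sigma''\sim\sigma_t}\deg(\sigma_t\cup\sigma'')$. Equivalently it is the random walk on the graph $G_i$ with vertex set $X(i)$ and $\deg(\sigma\cup\sigma')$ parallel edges between neighbors $\sigma\sim\sigma'$. For $i=0$ the walk is taken to be lazy: $\deg(v)$ self-loops are added at each vertex $v$ of $G_0$ (staying put with probability $1/2$). A random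 walk on a graph with stationary distribution $\pi$ is $\mu$-rapidly mixing ($0<\mu<1$) if for any initial distribution $\pi_0$ and any $t\in\mathbb N$, $\|\pi_t-\pi\|_2 \le \sqrt{d_{max}/d_{min}}\,\mu^t$, where $d_{max},d_{min}$ are the maximum and minimum vertex degrees of the graph.
   Formalization: The expansion constant ε and the initial distribution π₀ are taken rational rather than real; the ℓ₂ bound is stated in the equivalent squared form, and the walk for i=0 is lazy with staying probability exactly 1/2. -}

module Defs where

open import Data.Bool using (Bool; true; false; _∧_; _∨_; not; if_then_else_)
open import Data.Nat as ℕ using (ℕ; zero; suc; _≡ᵇ_; _⊔_; _⊓_)
open import Data.Vec using (Vec; []; _∷_)
open import Data.List using (List; []; _∷_; [_]; map; _++_; filterᵇ; foldr; length)
open import Data.Bool.ListAction using (any)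
open import Data.Nat.ListAction using (sum)
open import Data.List.Relation.Unary.All using (All)
open import Data.List.Relation.Unary.Unique.Propositional using (Unique)
open import Data.Fin.Subset using (Subset; ∣_∣; _∪_)
open import Data.Integer using (+_)
open import Data.Rational using (ℚ; 0ℚ; 1ℚ; ½; _+_; _*_; _-_; _/_; _≤_; _<_)
open import Relation.Binary.PropositionalEquality using (_≡_; _≢_)

isSub : ∀ {n} → Subset n → Subset n → Bool
isSub [] [] = true
isSub (x ∷ xs) (y ∷ ys) = (not x ∨ y) ∧ isSub xs ys

eqS : ∀ {n} → Subset n → Subset n → Bool
eqS [] [] = true
eqS (x ∷ xs) (y ∷ ys) = ((x ∧ y) ∨ (not x ∧ not y)) ∧ eqS xs ys

allSubsets : (n : ℕ) → List (Subset n)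
allSubsets zero = [ [] ]
allSubsets (suc n) = map (false ∷_) (allSubsets n) ++ map (true ∷_) (allSubsets n)

-- rational a / b, with the convention a / 0 = 0 (only used where b > 0)
frac : ℕ → ℕ → ℚ
frac a zero = 0ℚ
frac a (suc b) = (+ a) / suc b

sumℚ : List ℚ → ℚ
sumℚ = foldr _+_ 0ℚ

_^ℚ_ : ℚ → ℕ → ℚ
q ^ℚ zero = 1ℚ
q ^ℚ suc t = q * (q ^ℚ t)

maxL : List ℕ → ℕ
maxL = foldr _⊔_ 0

minL : List ℕ → ℕ
minL [] = 0
minL (x ∷ xs) = foldr _⊓_ x xs

-- A pure d-dimensional simplicial complex on vertex set Fin n, given by
-- its (distinct, nonempty list of) facets, each a (d+1)-element set.
-- The complex is the downward closure of the facets.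

record PureComplex (n d : ℕ) : Set where
  field
    facets    : List (Subset n)
    facetSize : All (λ f → ∣ f ∣ ≡ suc d) facets
    nonempty  : facets ≢ []
    distinct  : Unique facets

module _ {n d : ℕ} (X : PureComplex n d) where
  open PureComplex X

  isFace : ℕ → Subset n → Bool
  isFace k s = (∣ s ∣ ≡ᵇ suc k) ∧ any (isSub s) facets

  faces : ℕ → List (Subset n)
  faces k = filterᵇ (isFace k) (allSubsets n)

  deg : Subset n → ℕ
  deg s = length (filterᵇ (isSub s) facets)

  degSum : List (Subset n) → ℕ
  degSum L = sum (map deg L)

  normL : ℕ → List (Subset n) → ℚ
  normL k L = frac (degSum L) (degSum (faces k))

  -- a k-cochain W ⊆ X(k) is given by its indicator W : Subset n → Bool
  -- (only its values on X(k) matter)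
  norm : ℕ → (Subset n → Bool) → ℚ
  norm k W = normL k (filterᵇ W (faces k))

  ψ : ℕ → (Subset n → Bool) → List (Subset n)
  ψ k W = filterᵇ
    (λ τ → any (λ σ → isSub σ τ ∧ W σ) (faces k)
         ∧ any (λ σ → isSub σ τ ∧ not (W σ)) (faces k))
    (faces (suc k))

  -- ε-colorful expander (‖ψ(W)‖/‖W‖ ≥ ε written as ε‖W‖ ≤ ‖ψ(W)‖, ‖W‖ > 0)
  ColorfulExpander : ℚ → Set
  ColorfulExpander ε =
    ∀ i → i ℕ.< d → (W : Subset n → Bool) →
    0ℚ < norm i W → norm i W ≤ ½ →
    ε * norm i W ≤ normL (suc i) (ψ i W)

  -- number of (non-loop) edges between σ and σ' : deg(σ ∪ σ') if σ ∼ σ'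
  nbrW : ℕ → Subset n → Subset n → ℕ
  nbrW i σ σ' = if isFace (suc i) (σ ∪ σ') then deg (σ ∪ σ') else 0

  nbrDeg : ℕ → Subset n → ℕ
  nbrDeg i σ = sum (map (nbrW i σ) (faces i))

  -- edge multiplicities of G_i; for i = 0 the lazy walk: self-loops of
  -- total weight equal to the non-loop weight (stay probability 1/2)
  gW : ℕ → Subset n → Subset n → ℕ
  gW zero σ σ' = nbrW zero σ σ' ℕ.+ (if eqS σ σ' then nbrDeg zero σ else 0)
  gW (suc i) σ σ' = nbrW (suc i) σ σ'

  gDeg : ℕ → Subset n → ℕ
  gDeg i σ = sum (map (gW i σ) (faces i))

  P : ℕ → Subset n → Subset n → ℚ
  P i σ σ' = frac (gW i σ σ') (gDeg i σ)

  step : ℕ → (Subset n → ℚ) → (Subset n → ℚ)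
  step i π σ' = sumℚ (map (λ σ → π σ * P i σ σ') (faces i))

  walk : ℕ → (Subset n → ℚ) → ℕ → (Subset n → ℚ)
  walk i π₀ zero = π₀
  walk i π₀ (suc t) = step i (walk i π₀ t)

  stationary : ℕ → Subset n → ℚ
  stationary i σ = frac (gDeg i σ) (sum (map (gDeg i) (faces i)))

  IsDistribution : ℕ → (Subset n → ℚ) → Set
  IsDistribution i π = All (λ σ → 0ℚ ≤ π σ) (faces i) × (sumℚ (map π (faces i)) ≡ 1ℚ)
    where open import Data.Product using (_×_)

  dist² : ℕ → (Subset n → ℚ) → (Subset n → ℚ) → ℚ
  dist² i π π' = sumℚ (map (λ σ → (π σ - π' σ) * (π σ - π' σ)) (faces i))

  dmax dmin : ℕ → ℕ
  dmax i = maxL (map (gDeg i) (faces i))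
  dmin i = minL (map (gDeg i) (faces i))

  -- μ-rapidly mixing, with both sides of the ℓ₂ bound squared:
  -- ‖π_t − π‖₂² ≤ (d_max/d_min) μ^{2t}
  RapidlyMixing : ℕ → ℚ → Set
  RapidlyMixing i μ =
    (0ℚ < μ) × (μ < 1ℚ) ×
    (∀ (π₀ : Subset n → ℚ) → IsDistribution i π₀ → ∀ (t : ℕ) →
       dist² i (walk i π₀ t) (stationary i) ≤ frac (dmax i) (dmin i) * ((μ ^ℚ t) * (μ ^ℚ t)))
    where open import Data.Product using (_×_)

muBound : ℕ → ℚ → ℚ
muBound d ε = 1ℚ - (ε * ε) * frac 1 (2 ℕ.* (suc d ℕ.* suc d))

{-# OPTIONS --safe #-}
module Submission where

-- Let f be the density of a signed measure of total mass 0 with respect to the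
-- degree measure D of G_i.  The walk contracts ∑ D f² by μ² as soon as
-- |⟨f, Nf⟩| ≤ μ ∑ D f², by polarisation; no spectral theorem is needed.
--
-- Upper bound: the expansion hypothesis bounds the conductance of G_i below by
-- h = ε / (i+2), because a coface τ having a ≥ 1 facets in W and
-- b ≥ 1 outside contributes ab ≥ a + b - 1 = i + 1 cut pairs.  Cheeger's argument
-- (shift f by a median, split into positive and negative parts, coarea formula for
-- their squares) then gives ⟨f, Nf⟩ ≤ (1 - h²/2) ∑ D f².
--
-- Lower bound: ⟨f, Nf⟩ + ∑ D f² / (i+1) is a sum over τ of squares
-- deg τ (∑_{σ ⊂ τ} f σ)².  For i ≥ 1 this gives -1/2, and μ ≥ 1/2 since testing
-- expansion on a set of vertices forces ε ≤ 2; for i = 0 laziness makes the form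
-- nonnegative, and halves the gap to ε²/16 ≥ ε²/(2(d+1)²).

open import Defs
open import Data.Bool using (Bool; true; false; _∧_; _∨_; not; if_then_else_; T)
open import Data.Bool.ListAction using (any)
import Data.Bool.Properties as Boolₚ
open import Data.Fin.Subset using (Subset; _∪_) renaming (∣_∣ to size)
open import Data.Fin.Subset.Properties using (∪-comm; ∪-idem)
import Data.Integer as ℤ
import Data.Integer.Properties as ℤₚ
open import Data.List using (List; []; _∷_; _++_; filter; filterᵇ; foldr; length; map)
open import Data.List.Membership.Propositional using (_∈_; lose)
open import Data.List.Membership.Propositional.Properties using (∈-filter⁺; ∈-filter⁻; ∈-map⁺; ∈-++⁺ˡ; ∈-++⁺ʳ)
open import Data.List.Properties using (filter-notAll)
open import Data.List.Relation.Unary.All as All using (All)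
open import Data.List.Relation.Unary.Any using (here; there)
open import Data.Nat as ℕ using (ℕ; zero; suc; _≡ᵇ_)
open import Data.Nat.ListAction using (sum)
import Data.Nat.Properties as ℕₚ
open import Data.Product using (∃; _×_; _,_; proj₁; proj₂)
open import Data.Rational
open import Data.Rational.Properties
import Data.Rational.Unnormalised as ℚᵘ
import Data.Rational.Unnormalised.Properties as ℚᵘₚ
open import Data.Sum using (_⊎_; inj₁; inj₂)
open import Data.Unit using (tt)
open import Data.Vec using ([]; _∷_; head; tail)
open import Function using (_∘_)
open import Level using (0ℓ)
open import Relation.Binary.PropositionalEquality
open import Relation.Nullary using (¬_; Dec; yes; no; does; contradiction)
open import Relation.Nullary.Decidable using (dec⇒maybe; dec-true; dec-false; toWitness)
open import Tactic.RingSolver using (solve-∀)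
open import Tactic.RingSolver.Core.AlmostCommutativeRing using (AlmostCommutativeRing; fromCommutativeRing)

-- All computations stay in ℚ, while eigenvalues and square roots may be irrational. Hence
-- Cauchy-Schwarz in Cheeger's argument is replaced by the weighted inequality `young`; its weight
-- can be the conductance `h` itself, because `h` is known in advance and is the value for which the
-- two sides balance.
--
-- The factor `dmax / dmin` is the price of moving between the plain ℓ² norm and the norm weighted
-- by inverse degrees, for which the walk is symmetric: `1 / dmin` is paid at time 0 and `dmax` at
-- time `t`.
--
-- The constant in `μ` comes from the top dimension: for `i = d - 1` one has `h = ε / (d+1)`, and
-- then `1 - h²/2` is exactly `μ`. Lower dimensions have larger `h`. The assumption `1 < d` supplies
-- `2(d+1)² ≥ 16`, on which both the lazy walk and `½ ≤ μ` rely.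

ℚ-ring : AlmostCommutativeRing 0ℓ 0ℓ
ℚ-ring = fromCommutativeRing +-*-commutativeRing (λ p → dec⇒maybe (0ℚ ≟ p))

-- Order

p≤q⇒0≤q-p : ∀ {p q} → p ≤ q → 0ℚ ≤ q - p
p≤q⇒0≤q-p {p} {q} p≤q = subst (_≤ q - p) (+-inverseʳ p) (+-monoˡ-≤ (- p) p≤q)

0≤q-p⇒p≤q : ∀ {p q} → 0ℚ ≤ q - p → p ≤ q
0≤q-p⇒p≤q {p} {q} 0≤q-p = subst₂ _≤_ (+-identityˡ p) (cancel q p) (+-monoˡ-≤ p 0≤q-p)
  where
  cancel : ∀ q p → q - p + p ≡ q
  cancel = solve-∀ ℚ-ring

p<q⇒0<q-p : ∀ {p q} → p < q → 0ℚ < q - p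
p<q⇒0<q-p {p} {q} p<q = subst (_< q - p) (+-inverseʳ p) (+-monoˡ-< (- p) p<q)

≤-by-gap : ∀ {p q} r → q - p ≡ r → 0ℚ ≤ r → p ≤ q
≤-by-gap r eq 0≤r = 0≤q-p⇒p≤q (subst (0ℚ ≤_) (sym eq) 0≤r)

0≤+ : ∀ {p q} → 0ℚ ≤ p → 0ℚ ≤ q → 0ℚ ≤ p + q
0≤+ = +-mono-≤

0≤* : ∀ {p q} → 0ℚ ≤ p → 0ℚ ≤ q → 0ℚ ≤ p * q
0≤* {p} {q} 0≤p 0≤q = nonNegative⁻¹ (p * q) {{nonNeg*nonNeg⇒nonNeg p {{nonNegative 0≤p}} q {{nonNegative 0≤q}}}}

0<* : ∀ {p q} → 0ℚ < p → 0ℚ < q → 0ℚ < p * q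
0<* {p} {q} 0<p 0<q = positive⁻¹ (p * q) {{pos*pos⇒pos p {{positive 0<p}} q {{positive 0<q}}}}

0≤p² : ∀ p → 0ℚ ≤ p * p
0≤p² p with ≤-total 0ℚ p
... | inj₁ 0≤p = 0≤* 0≤p 0≤p
... | inj₂ p≤0 = subst (0ℚ ≤_) (neg² p) (0≤* (neg-antimono-≤ p≤0) (neg-antimono-≤ p≤0))
  where
  neg² : ∀ p → - p * - p ≡ p * p
  neg² = solve-∀ ℚ-ring

*-monoˡ-≤ : ∀ {p q} r → 0ℚ ≤ r → p ≤ q → r * p ≤ r * q
*-monoˡ-≤ r 0≤r = *-monoˡ-≤-nonNeg r {{nonNegative 0≤r}}

*-cancelˡ-≤ : ∀ {p q} r → 0ℚ < r → r * p ≤ r * q → p ≤ q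
*-cancelˡ-≤ r 0<r = *-cancelˡ-≤-pos r {{positive 0<r}}

0≤1 : 0ℚ ≤ 1ℚ
0≤1 = nonNegative⁻¹ 1ℚ

0≤½ : 0ℚ ≤ ½
0≤½ = nonNegative⁻¹ ½

χ : Bool → ℚ
χ true  = 1ℚ
χ false = 0ℚ

0≤χ : ∀ b → 0ℚ ≤ χ b
0≤χ true  = 0≤1
0≤χ false = ≤-refl

χ-∧ : ∀ a b → χ (a ∧ b) ≡ χ a * χ b
χ-∧ true  b = sym (*-identityˡ (χ b))
χ-∧ false b = sym (*-zeroˡ (χ b))

χ-not : ∀ a → χ a + χ (not a) ≡ 1ℚ
χ-not true  = +-identityʳ 1ℚ
χ-not false = +-identityˡ 1ℚ

χ-mono : ∀ {a b} → (a ≡ true → b ≡ true) → χ a ≤ χ b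
χ-mono {false} {b} f = 0≤χ b
χ-mono {true}  {b} f rewrite f refl = ≤-refl

-- Finite sums

module _ {A : Set} where

  ∑ : List A → (A → ℚ) → ℚ
  ∑ L f = sumℚ (map f L)

  ∑-cong : ∀ L {f g : A → ℚ} → (∀ {x} → x ∈ L → f x ≡ g x) → ∑ L f ≡ ∑ L g
  ∑-cong []      eq = refl
  ∑-cong (x ∷ L) eq = cong₂ _+_ (eq (here refl)) (∑-cong L (eq ∘ there))

  ∑-mono : ∀ L {f g : A → ℚ} → (∀ {x} → x ∈ L → f x ≤ g x) → ∑ L f ≤ ∑ L g
  ∑-mono []      le = ≤-refl
  ∑-mono (x ∷ L) le = +-mono-≤ (le (here refl)) (∑-mono L (le ∘ there))

  ∑-0 : ∀ (L : List A) → ∑ L (λ _ → 0ℚ) ≡ 0ℚ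
  ∑-0 []      = refl
  ∑-0 (x ∷ L) = trans (+-identityˡ _) (∑-0 L)

  ∑-zero : ∀ L {f : A → ℚ} → (∀ {x} → x ∈ L → f x ≡ 0ℚ) → ∑ L f ≡ 0ℚ
  ∑-zero L eq = trans (∑-cong L eq) (∑-0 L)

  0≤∑ : ∀ L {f : A → ℚ} → (∀ {x} → x ∈ L → 0ℚ ≤ f x) → 0ℚ ≤ ∑ L f
  0≤∑ L {f} le = subst (_≤ ∑ L f) (∑-0 L) (∑-mono L le)

  ∑-+ : ∀ L (f g : A → ℚ) → ∑ L (λ x → f x + g x) ≡ ∑ L f + ∑ L g
  ∑-+ []      f g = refl
  ∑-+ (x ∷ L) f g = trans (cong (f x + g x +_) (∑-+ L f g)) (interchange (f x) (g x) (∑ L f) (∑ L g))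
    where
    interchange : ∀ a b c d → a + b + (c + d) ≡ a + c + (b + d)
    interchange = solve-∀ ℚ-ring

  ∑-*ˡ : ∀ L c (f : A → ℚ) → ∑ L (λ x → c * f x) ≡ c * ∑ L f
  ∑-*ˡ []      c f = sym (*-zeroʳ c)
  ∑-*ˡ (x ∷ L) c f = trans (cong (c * f x +_) (∑-*ˡ L c f)) (sym (*-distribˡ-+ c (f x) (∑ L f)))

  ∑-*ʳ : ∀ L c (f : A → ℚ) → ∑ L (λ x → f x * c) ≡ ∑ L f * c
  ∑-*ʳ L c f = trans (∑-cong L (λ {x} _ → *-comm (f x) c)) (trans (∑-*ˡ L c f) (*-comm c (∑ L f)))

  ∑-- : ∀ L (f g : A → ℚ) → ∑ L (λ x → f x - g x) ≡ ∑ L f - ∑ L g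
  ∑-- []      f g = refl
  ∑-- (x ∷ L) f g = trans (cong (f x - g x +_) (∑-- L f g)) (interchange (f x) (g x) (∑ L f) (∑ L g))
    where
    interchange : ∀ a b c d → a - b + (c - d) ≡ a + c - (b + d)
    interchange = solve-∀ ℚ-ring

  ∑-++ : ∀ L M (f : A → ℚ) → ∑ (L ++ M) f ≡ ∑ L f + ∑ M f
  ∑-++ []      M f = sym (+-identityˡ _)
  ∑-++ (x ∷ L) M f = trans (cong (f x +_) (∑-++ L M f)) (sym (+-assoc (f x) (∑ L f) (∑ M f)))

  ∑-filterᵇ : ∀ (p : A → Bool) L (f : A → ℚ) → ∑ (filterᵇ p L) f ≡ ∑ L (λ x → χ (p x) * f x)
  ∑-filterᵇ p []      f = refl
  ∑-filterᵇ p (x ∷ L) f with p x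
  ... | true  = cong₂ _+_ (sym (*-identityˡ (f x))) (∑-filterᵇ p L f)
  ... | false = trans (sym (+-identityˡ _)) (cong₂ _+_ (sym (*-zeroˡ (f x))) (∑-filterᵇ p L f))

  ∑-member : ∀ L {f : A → ℚ} → (∀ {x} → x ∈ L → 0ℚ ≤ f x) → ∀ {x} → x ∈ L → f x ≤ ∑ L f
  ∑-member (y ∷ L) {f} 0≤f (here refl) = subst (_≤ f y + ∑ L f) (+-identityʳ (f y)) (+-monoʳ-≤ (f y) (0≤∑ L (0≤f ∘ there)))
  ∑-member (y ∷ L) {f} 0≤f {x} (there x∈) = subst (_≤ f y + ∑ L f) (+-identityˡ (f x)) (+-mono-≤ (0≤f (here refl)) (∑-member L (0≤f ∘ there) x∈))

  ∑²≤[∑]² : ∀ L {f : A → ℚ} → (∀ {x} → x ∈ L → 0ℚ ≤ f x) → ∑ L (λ x → f x * f x) ≤ ∑ L f * ∑ L f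
  ∑²≤[∑]² []      0≤f = ≤-refl
  ∑²≤[∑]² (x ∷ L) {f} 0≤f = ≤-by-gap _ (gap (f x) (∑ L f) (∑ L (λ x → f x * f x)))
      (0≤+ (p≤q⇒0≤q-p (∑²≤[∑]² L (0≤f ∘ there))) (0≤+ 0≤ab 0≤ab))
    where
    0≤ab : 0ℚ ≤ f x * ∑ L f
    0≤ab = 0≤* (0≤f (here refl)) (0≤∑ L (0≤f ∘ there))
    gap : ∀ a b c → (a + b) * (a + b) - (a * a + c) ≡ b * b - c + (a * b + a * b)
    gap = solve-∀ ℚ-ring

  ∃-min : ∀ (f : A → ℚ) x L → ∃ λ m → m ∈ x ∷ L × (∀ {y} → y ∈ x ∷ L → f m ≤ f y)
  ∃-min f x [] = x , here refl , λ { (here refl) → ≤-refl }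
  ∃-min f x (y ∷ L) with ∃-min f y L
  ... | m , m∈ , m≤ with ≤-total (f x) (f m)
  ...   | inj₁ x≤m = x , here refl , λ { (here refl) → ≤-refl ; (there z∈) → ≤-trans x≤m (m≤ z∈) }
  ...   | inj₂ m≤x = m , there m∈ , λ { (here refl) → m≤x ; (there z∈) → m≤ z∈ }

∑-swap : ∀ {A B : Set} (L : List A) (M : List B) (f : A → B → ℚ) →
  ∑ L (λ x → ∑ M (f x)) ≡ ∑ M (λ y → ∑ L (λ x → f x y))
∑-swap []      M f = sym (∑-0 M)
∑-swap (x ∷ L) M f = trans (cong (∑ M (f x) +_) (∑-swap L M f)) (sym (∑-+ M (f x) (λ y → ∑ L (λ x → f x y))))

∑-map : ∀ {A B : Set} (h : A → B) L (f : B → ℚ) → ∑ (map h L) f ≡ ∑ L (f ∘ h)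
∑-map h []      f = refl
∑-map h (x ∷ L) f = cong (f (h x) +_) (∑-map h L f)

-- The Cheeger inequality

_<ᵇ_ : ℚ → ℚ → Bool
p <ᵇ q = does (p <? q)

<ᵇ-sound : ∀ {p q} → p <ᵇ q ≡ true → p < q
<ᵇ-sound {p} {q} = does-sound (p <? q)
  where
  does-sound : ∀ {P : Set} (P? : Dec P) → does P? ≡ true → P
  does-sound (yes p) _ = p

<⇒χ≡1 : ∀ {p q} → p < q → χ (p <ᵇ q) ≡ 1ℚ
<⇒χ≡1 {p} {q} p<q = cong χ (dec-true (p <? q) p<q)

≮⇒χ≡0 : ∀ {p q} → ¬ p < q → χ (p <ᵇ q) ≡ 0ℚ
≮⇒χ≡0 {p} {q} p≮q = cong χ (dec-false (p <? q) p≮q)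

-- The gap is a sum of two squares, one for each sign of `a² - b²`. Summed over weighted pairs, it
-- bounds the variation of `u²` by the energy of `u` without a square root.
young : ∀ h a b → h * ∣ a * a - b * b ∣ ≤ (a - b) * (a - b) + ½ * (h * h) * (a * a + b * b)
young h a b with ∣p∣≡p∨∣p∣≡-p (a * a - b * b)
... | inj₁ eq rewrite eq = ≤-by-gap _ (gap h a b)
    (0≤+ (0≤p² (a - b - ½ * h * (a + b))) (0≤p² (½ * h * (a - b))))
  where
  gap : ∀ h a b → (a - b) * (a - b) + ½ * (h * h) * (a * a + b * b) - h * (a * a - b * b)
    ≡ (a - b - ½ * h * (a + b)) * (a - b - ½ * h * (a + b)) + (½ * h * (a - b)) * (½ * h * (a - b))
  gap = solve-∀ ℚ-ring
... | inj₂ eq rewrite eq = ≤-by-gap _ (gap h a b)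
    (0≤+ (0≤p² (b - a - ½ * h * (a + b))) (0≤p² (½ * h * (a - b))))
  where
  gap : ∀ h a b → (a - b) * (a - b) + ½ * (h * h) * (a * a + b * b) - h * - (a * a - b * b)
    ≡ (b - a - ½ * h * (a + b)) * (b - a - ½ * h * (a + b)) + (½ * h * (a - b)) * (½ * h * (a - b))
  gap = solve-∀ ℚ-ring

infix 8 _⁺
_⁺ : ℚ → ℚ
p ⁺ = p ⊔ 0ℚ

posneg : ∀ p → (0ℚ ≤ p × p ⁺ ≡ p × (- p) ⁺ ≡ 0ℚ) ⊎ (p ≤ 0ℚ × p ⁺ ≡ 0ℚ × (- p) ⁺ ≡ - p)
posneg p with ≤-total 0ℚ p
... | inj₁ 0≤p = inj₁ (0≤p , p≥q⇒p⊔q≡p 0≤p , p≤q⇒p⊔q≡q (neg-antimono-≤ 0≤p))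
... | inj₂ p≤0 = inj₂ (p≤0 , p≤q⇒p⊔q≡q p≤0 , p≥q⇒p⊔q≡p (neg-antimono-≤ p≤0))

posneg-² : ∀ p → p ⁺ * p ⁺ + (- p) ⁺ * (- p) ⁺ ≡ p * p
posneg-² p with posneg p
... | inj₁ (_ , e₁ , e₂) rewrite e₁ | e₂ = eq p
  where
  eq : ∀ p → p * p + 0ℚ * 0ℚ ≡ p * p
  eq = solve-∀ ℚ-ring
... | inj₂ (_ , e₁ , e₂) rewrite e₁ | e₂ = eq p
  where
  eq : ∀ p → 0ℚ * 0ℚ + - p * - p ≡ p * p
  eq = solve-∀ ℚ-ring

-- Equal signs give equality; opposite signs leave the nonnegative cross term as the gap. It allows
-- the energies of the positive and the negative part to be bounded separately and then added.
posneg-contract : ∀ p q →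
  (p ⁺ - q ⁺) * (p ⁺ - q ⁺) + ((- p) ⁺ - (- q) ⁺) * ((- p) ⁺ - (- q) ⁺) ≤ (p - q) * (p - q)
posneg-contract p q with posneg p | posneg q
... | inj₁ (_ , e₁ , e₂) | inj₁ (_ , e₃ , e₄) rewrite e₁ | e₂ | e₃ | e₄ = ≤-reflexive (eq p q)
  where
  eq : ∀ p q → (p - q) * (p - q) + (0ℚ - 0ℚ) * (0ℚ - 0ℚ) ≡ (p - q) * (p - q)
  eq = solve-∀ ℚ-ring
... | inj₂ (_ , e₁ , e₂) | inj₂ (_ , e₃ , e₄) rewrite e₁ | e₂ | e₃ | e₄ = ≤-reflexive (eq p q)
  where
  eq : ∀ p q → (0ℚ - 0ℚ) * (0ℚ - 0ℚ) + (- p - - q) * (- p - - q) ≡ (p - q) * (p - q)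
  eq = solve-∀ ℚ-ring
... | inj₁ (0≤p , e₁ , e₂) | inj₂ (q≤0 , e₃ , e₄) rewrite e₁ | e₂ | e₃ | e₄ =
  ≤-by-gap _ (eq p q) (0≤+ 0≤pq 0≤pq)
  where
  0≤pq : 0ℚ ≤ p * - q
  0≤pq = 0≤* 0≤p (neg-antimono-≤ q≤0)
  eq : ∀ p q → (p - q) * (p - q) - ((p - 0ℚ) * (p - 0ℚ) + (0ℚ - - q) * (0ℚ - - q)) ≡ p * - q + p * - q
  eq = solve-∀ ℚ-ring
... | inj₂ (p≤0 , e₁ , e₂) | inj₁ (0≤q , e₃ , e₄) rewrite e₁ | e₂ | e₃ | e₄ =
  ≤-by-gap _ (eq p q) (0≤+ 0≤pq 0≤pq)
  where
  0≤pq : 0ℚ ≤ - p * q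
  0≤pq = 0≤* (neg-antimono-≤ p≤0) 0≤q
  eq : ∀ p q → (p - q) * (p - q) - ((0ℚ - q) * (0ℚ - q) + (- p - 0ℚ) * (- p - 0ℚ)) ≡ - p * q + - p * q
  eq = solve-∀ ℚ-ring

-- Quadratic forms, energy and volume on a weighted graph.

module WeightedGraph {A : Set} (V : List A) (w : A → A → ℚ)
  (0≤w : ∀ x y → 0ℚ ≤ w x y) (w-sym : ∀ x y → w x y ≡ w y x) where

  D : A → ℚ
  D x = ∑ V (w x)

  ∑∑ : (A → A → ℚ) → ℚ
  ∑∑ F = ∑ V λ x → ∑ V λ y → w x y * F x y

  form : (A → ℚ) → (A → ℚ) → ℚ
  form f g = ∑∑ λ x y → f x * g y

  normD : (A → ℚ) → ℚ
  normD f = ∑ V λ x → D x * (f x * f x)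

  energy : (A → ℚ) → ℚ
  energy f = ∑∑ λ x y → (f x - f y) * (f x - f y)

  -- The sum runs over ordered pairs, so for `χ ∘ W` every cut edge counts twice; this is why
  -- conductance bounds carry `h + h`.
  variation : (A → ℚ) → ℚ
  variation f = ∑∑ λ x y → ∣ f x - f y ∣

  vol : (A → Bool) → ℚ
  vol W = ∑ V λ x → D x * χ (W x)

  total : ℚ
  total = ∑ V D

  0≤D : ∀ x → 0ℚ ≤ D x
  0≤D x = 0≤∑ V (λ {y} _ → 0≤w x y)

  ∑∑-cong : ∀ {F G} → (∀ {x y} → x ∈ V → y ∈ V → F x y ≡ G x y) → ∑∑ F ≡ ∑∑ G
  ∑∑-cong eq = ∑-cong V λ {x} x∈ → ∑-cong V λ {y} y∈ → cong (w x y *_) (eq x∈ y∈)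

  ∑∑-mono : ∀ {F G} → (∀ {x y} → x ∈ V → y ∈ V → F x y ≤ G x y) → ∑∑ F ≤ ∑∑ G
  ∑∑-mono le = ∑-mono V λ {x} x∈ → ∑-mono V λ {y} y∈ → *-monoˡ-≤ (w x y) (0≤w x y) (le x∈ y∈)

  0≤∑∑ : ∀ {F} → (∀ {x y} → x ∈ V → y ∈ V → 0ℚ ≤ F x y) → 0ℚ ≤ ∑∑ F
  0≤∑∑ le = 0≤∑ V λ {x} x∈ → 0≤∑ V λ {y} y∈ → 0≤* (0≤w x y) (le x∈ y∈)

  ∑∑-+ : ∀ F G → ∑∑ (λ x y → F x y + G x y) ≡ ∑∑ F + ∑∑ G
  ∑∑-+ F G = trans (∑-cong V λ {x} _ → trans
    (∑-cong V λ {y} _ → *-distribˡ-+ (w x y) (F x y) (G x y))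
    (∑-+ V (λ y → w x y * F x y) (λ y → w x y * G x y)))
    (∑-+ V (λ x → ∑ V λ y → w x y * F x y) (λ x → ∑ V λ y → w x y * G x y))

  ∑∑-*ˡ : ∀ c F → ∑∑ (λ x y → c * F x y) ≡ c * ∑∑ F
  ∑∑-*ˡ c F = trans (∑-cong V λ {x} _ → trans
    (∑-cong V λ {y} _ → left-comm (w x y) c (F x y))
    (∑-*ˡ V c (λ y → w x y * F x y)))
    (∑-*ˡ V c (λ x → ∑ V λ y → w x y * F x y))
    where
    left-comm : ∀ a b c → a * (b * c) ≡ b * (a * c)
    left-comm = solve-∀ ℚ-ring

  ∑∑-left : ∀ (g : A → ℚ) → ∑∑ (λ x _ → g x) ≡ ∑ V λ x → D x * g x
  ∑∑-left g = ∑-cong V λ {x} _ → ∑-*ʳ V (g x) (w x)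

  ∑∑-right : ∀ (g : A → ℚ) → ∑∑ (λ _ y → g y) ≡ ∑ V λ x → D x * g x
  ∑∑-right g = trans (∑-swap V V (λ x y → w x y * g y))
    (trans (∑-cong V λ {y} _ → ∑-cong V λ {x} _ → cong (_* g y) (w-sym x y)) (∑∑-left g))

  form-sym : ∀ f g → form f g ≡ form g f
  form-sym f g = trans (∑-swap V V _) (∑-cong V λ {y} _ → ∑-cong V λ {x} _ → cong₂ _*_ (w-sym x y) (*-comm (f x) (g y)))

  energy-form : ∀ f → energy f ≡ normD f + normD f - (form f f + form f f)
  energy-form f = begin
    energy f
      ≡⟨ ∑∑-cong (λ {x} {y} _ _ → expand (f x) (f y)) ⟩
    ∑∑ (λ x y → f x * f x + f y * f y + (- 1ℚ - 1ℚ) * (f x * f y))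
      ≡⟨ ∑∑-+ _ _ ⟩
    ∑∑ (λ x y → f x * f x + f y * f y) + ∑∑ (λ x y → (- 1ℚ - 1ℚ) * (f x * f y))
      ≡⟨ cong₂ _+_ (trans (∑∑-+ _ _) (cong₂ _+_ (∑∑-left _) (∑∑-right _))) (∑∑-*ˡ (- 1ℚ - 1ℚ) (λ x y → f x * f y)) ⟩
    normD f + normD f + (- 1ℚ - 1ℚ) * form f f
      ≡⟨ collect (normD f) (form f f) ⟩
    normD f + normD f - (form f f + form f f) ∎
    where
    open ≡-Reasoning
    expand : ∀ a b → (a - b) * (a - b) ≡ a * a + b * b + (- 1ℚ - 1ℚ) * (a * b)
    expand = solve-∀ ℚ-ring
    collect : ∀ n q → n + n + (- 1ℚ - 1ℚ) * q ≡ n + n - (q + q)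
    collect = solve-∀ ℚ-ring

  vol-mono : ∀ {W W′} → (∀ {x} → x ∈ V → W x ≡ true → W′ x ≡ true) → vol W ≤ vol W′
  vol-mono W⊆W′ = ∑-mono V λ {x} x∈ → *-monoˡ-≤ (D x) (0≤D x) (χ-mono (W⊆W′ x∈))

  -- A cut edge has an endpoint in `W`, in either order of the pair. Played against the conductance
  -- bound, this trivial estimate forces `h ≤ 1`.
  variation-χ≤2vol : ∀ W → variation (χ ∘ W) ≤ vol W + vol W
  variation-χ≤2vol W = subst (variation (χ ∘ W) ≤_)
    (trans (∑∑-+ _ _) (cong₂ _+_ (∑∑-left (χ ∘ W)) (∑∑-right (χ ∘ W))))
    (∑∑-mono λ {x} {y} _ _ → pointwise (W x) (W y))
    where
    pointwise : ∀ a b → ∣ χ a - χ b ∣ ≤ χ a + χ b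
    pointwise true  true  = *≤* (ℤ.+≤+ ℕ.z≤n)
      where import Data.Integer as ℤ
    pointwise true  false = ≤-refl
    pointwise false true  = ≤-refl
    pointwise false false = ≤-refl

  -- Conductance only speaks of sets of at most half the volume, so `f` has to be cut at a level
  -- that leaves both the part above and the part below that small.
  ∃-median : ∀ (f : A → ℚ) → ∃ λ c → vol (λ x → f x <ᵇ c) ≤ ½ * total × vol (λ x → c <ᵇ f x) ≤ ½ * total
  ∃-median f = find V refl
    where
    0≤½total : 0ℚ ≤ ½ * total
    0≤½total = 0≤* 0≤½ (0≤∑ V (λ {x} _ → 0≤D x))

    vol-empty : ∀ W → (∀ {x} → x ∈ V → χ (W x) ≡ 0ℚ) → vol W ≤ ½ * total
    vol-empty W W≡∅ = subst (_≤ ½ * total) (sym (∑-zero V λ {x} x∈ → trans (cong (D x *_) (W≡∅ x∈)) (*-zeroʳ (D x)))) 0≤½total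

    Low : A → Set
    Low x = vol (λ y → f y <ᵇ f x) ≤ ½ * total

    low? : ∀ x → Dec (Low x)
    low? x = vol (λ y → f y <ᵇ f x) ≤? ½ * total

    -- c is the largest value below which at most half of the volume lies.
    module _ (L : List A) (L≡ : L ≡ filter low? V) where
      above : ∀ c → (∀ {y} → y ∈ L → f y ≤ c) → vol (λ x → c <ᵇ f x) ≤ ½ * total
      above c L≤c with vol (λ x → c <ᵇ f x) ≤? ½ * total
      ... | yes ok = ok
      ... | no ¬ok = search (filter (λ x → c <? f x) V) refl
        where
        search : ∀ M → M ≡ filter (λ x → c <? f x) V → vol (λ x → c <ᵇ f x) ≤ ½ * total
        search [] M≡ = vol-empty (λ x → c <ᵇ f x) λ x∈ → ≮⇒χ≡0 λ c<f →
          contradiction (subst (_ ∈_) (sym M≡) (∈-filter⁺ (λ x → c <? f x) x∈ c<f)) λ ()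
        search (z ∷ M) M≡ with ∃-min f z M
        -- If more than half the volume lay above `c`, let `y` carry the least value above `c`. The
        -- sets `f < f y` and `c < f` are disjoint, so the former has at most half the volume and
        -- `y` belongs to `L`, against the maximality of `c`.
        ... | y , y∈M , y-min with ∈-filter⁻ (λ x → c <? f x) {xs = V} (subst (y ∈_) M≡ y∈M)
        ...   | y∈V , c<fy = contradiction (<-≤-trans c<fy (L≤c y∈L)) (<-irrefl refl)
          where
          disjoint : ∀ {x} → x ∈ V → χ (f x <ᵇ f y) + χ (c <ᵇ f x) ≤ 1ℚ
          disjoint {x} x∈ with c <? f x
          ... | yes c<fx = ≤-reflexive (cong₂ _+_ (≮⇒χ≡0 λ fx<fy → <-irrefl refl (<-≤-trans fx<fy
                  (y-min (subst (x ∈_) (sym M≡) (∈-filter⁺ (λ x → c <? f x) x∈ c<fx))))) (<⇒χ≡1 c<fx))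
          ... | no  c≮fx = subst (λ q → χ (f x <ᵇ f y) + q ≤ 1ℚ) (sym (≮⇒χ≡0 c≮fx))
                  (subst (_≤ 1ℚ) (sym (+-identityʳ _)) (χ-mono {f x <ᵇ f y} {true} λ _ → refl))
          vols : vol (λ x → f x <ᵇ f y) + vol (λ x → c <ᵇ f x) ≤ total
          vols = subst₂ _≤_ (trans (∑-cong V λ {x} _ → *-distribˡ-+ (D x) _ _) (∑-+ V _ _))
            (∑-cong V λ {x} _ → *-identityʳ (D x))
            (∑-mono V λ {x} x∈ → *-monoˡ-≤ (D x) (0≤D x) (disjoint x∈))
          y∈L : y ∈ L
          y∈L = subst (y ∈_) (sym L≡) (∈-filter⁺ low? y∈V (≤-by-gap _
            (gap (vol (λ x → f x <ᵇ f y)) (vol (λ x → c <ᵇ f x)) total)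
            (0≤+ (p≤q⇒0≤q-p vols) (p≤q⇒0≤q-p (<⇒≤ (≰⇒> ¬ok))))))
            where
            gap : ∀ a b t → ½ * t - a ≡ t - (a + b) + (b - ½ * t)
            gap = solve-∀ ℚ-ring

    pick : ∀ L → L ≡ filter low? V → ∀ {b} → b ∈ L → ∃ λ c → vol (λ x → f x <ᵇ c) ≤ ½ * total × vol (λ x → c <ᵇ f x) ≤ ½ * total
    pick (z ∷ L) L≡ _ with ∃-min (λ x → - f x) z L
    ... | a , a∈L , a-max = f a , proj₂ (∈-filter⁻ low? {xs = V} (subst (a ∈_) L≡ a∈L)) ,
      above (z ∷ L) L≡ (f a) λ {y} y∈ → subst₂ _≤_ (neg-invol (f y)) (neg-invol (f a)) (neg-antimono-≤ (a-max y∈))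
      where
      neg-invol : ∀ p → - (- p) ≡ p
      neg-invol = solve-∀ ℚ-ring

    find : ∀ M → M ≡ V → ∃ λ c → vol (λ x → f x <ᵇ c) ≤ ½ * total × vol (λ x → c <ᵇ f x) ≤ ½ * total
    find [] refl = 0ℚ , ≤-refl , ≤-refl
    find (z ∷ M) refl with ∃-min f z M
    -- Nothing lies strictly below the least value, so its vertex satisfies `Low` and the list of
    -- candidates is inhabited.
    ... | b , b∈ , b-min = pick (filter low? V) refl
      (∈-filter⁺ low? b∈ (vol-empty (λ x → f x <ᵇ f b) λ x∈ → ≮⇒χ≡0 λ fx<fb → <-irrefl refl (<-≤-trans fx<fb (b-min x∈))))

  module Cheeger (h : ℚ) (0≤h : 0ℚ ≤ h)
    (conductance : ∀ W → vol W ≤ ½ * total → (h + h) * vol W ≤ variation (χ ∘ W)) where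

    -- Peels off the lowest layer v = v′ + m 1_W, with m the least positive value of v.
    coarea-fuel : ∀ n (v : A → ℚ) (L : List A) → length L ℕ.≤ n →
      (∀ {x} → x ∈ V → 0ℚ ≤ v x) →
      (∀ {x} → x ∈ V → 0ℚ < v x → x ∈ L) →
      (∀ {x} → x ∈ L → x ∈ V × 0ℚ < v x) →
      vol (λ x → 0ℚ <ᵇ v x) ≤ ½ * total →
      (h + h) * ∑ V (λ x → D x * v x) ≤ variation v
    coarea-fuel n v [] _ 0≤v supp⊆L L⊆supp small =
      subst (_≤ variation v) (sym lhs≡0) (0≤∑∑ λ {x} {y} _ _ → 0≤∣p∣ (v x - v y))
      where
      v≡0 : ∀ {x} → x ∈ V → v x ≡ 0ℚ
      v≡0 {x} x∈ with 0ℚ <? v x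
      ... | yes 0<v = contradiction (supp⊆L x∈ 0<v) λ ()
      ... | no  0≮v = ≤-antisym (≮⇒≥ 0≮v) (0≤v x∈)
      lhs≡0 : (h + h) * ∑ V (λ x → D x * v x) ≡ 0ℚ
      lhs≡0 = trans (cong ((h + h) *_) (∑-zero V λ {x} x∈ → trans (cong (D x *_) (v≡0 x∈)) (*-zeroʳ (D x)))) (*-zeroʳ (h + h))
    coarea-fuel (suc n) v L@(z ∷ L₀) (ℕ.s≤s |L|≤n) 0≤v supp⊆L L⊆supp small
      with ∃-min v z L₀
    ... | a , a∈L , a-min = begin
      (h + h) * ∑ V (λ x → D x * v x)
        ≡⟨ cong ((h + h) *_) (trans (∑-cong V λ {x} _ → split (D x) (v x) m (χ (W x))) (∑-+ V _ _)) ⟩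
      (h + h) * (∑ V (λ x → D x * v′ x) + ∑ V (λ x → m * (D x * χ (W x))))
        ≡⟨ cong (λ s → (h + h) * (∑ V (λ x → D x * v′ x) + s)) (∑-*ˡ V m _) ⟩
      (h + h) * (∑ V (λ x → D x * v′ x) + m * vol W)
        ≡⟨ regroup (h + h) (∑ V (λ x → D x * v′ x)) m (vol W) ⟩
      (h + h) * ∑ V (λ x → D x * v′ x) + m * ((h + h) * vol W)
        ≤⟨ +-mono-≤ rec (*-monoˡ-≤ m (<⇒≤ 0<m) (conductance W small)) ⟩
      variation v′ + m * variation (χ ∘ W)
        ≡⟨ cong (variation v′ +_) (∑∑-*ˡ m _) ⟨
      variation v′ + ∑∑ (λ x y → m * ∣ χ (W x) - χ (W y) ∣)
        ≡⟨ ∑∑-+ _ _ ⟨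
      ∑∑ (λ x y → ∣ v′ x - v′ y ∣ + m * ∣ χ (W x) - χ (W y) ∣)
        ≡⟨ ∑∑-cong layer ⟨
      variation v ∎
      where
      open ≤-Reasoning
      m : ℚ
      m = v a
      0<m : 0ℚ < m
      0<m = proj₂ (L⊆supp a∈L)
      W : A → Bool
      W x = 0ℚ <ᵇ v x
      v′ : A → ℚ
      v′ x = v x - m * χ (W x)
      split : ∀ d v m c → d * v ≡ d * (v - m * c) + m * (d * c)
      split = solve-∀ ℚ-ring
      regroup : ∀ k s m t → k * (s + m * t) ≡ k * s + m * (k * t)
      regroup = solve-∀ ℚ-ring

      -- By minimality of `m`, a value is either zero or at least `m`. So subtracting `m` on the
      -- support never changes the order of two values, and absolute differences split additively in
      -- `layer`.
      level : ∀ {x} → x ∈ V → (v x ≡ 0ℚ × χ (W x) ≡ 0ℚ) ⊎ (m ≤ v x × χ (W x) ≡ 1ℚ)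
      level {x} x∈ with 0ℚ <? v x
      ... | yes 0<v = inj₂ (a-min (supp⊆L x∈ 0<v) , <⇒χ≡1 0<v)
      ... | no  0≮v = inj₁ (≤-antisym (≮⇒≥ 0≮v) (0≤v x∈) , ≮⇒χ≡0 0≮v)

      p+m*0 : ∀ p → p + m * 0ℚ ≡ p
      p+m*0 p = trans (cong (p +_) (*-zeroʳ m)) (+-identityʳ p)

      layer : ∀ {x y} → x ∈ V → y ∈ V → ∣ v x - v y ∣ ≡ ∣ v′ x - v′ y ∣ + m * ∣ χ (W x) - χ (W y) ∣
      layer {x} {y} x∈ y∈ with level x∈ | level y∈
      ... | inj₁ (_ , e₁) | inj₁ (_ , e₂) rewrite e₁ | e₂ = same (v x) (v y)
        where
        same₀ : ∀ a b m → a - b ≡ a - m * 0ℚ - (b - m * 0ℚ)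
        same₀ = solve-∀ ℚ-ring
        same : ∀ a b → ∣ a - b ∣ ≡ ∣ a - m * 0ℚ - (b - m * 0ℚ) ∣ + m * 0ℚ
        same a b = trans (cong ∣_∣ (same₀ a b m)) (sym (p+m*0 _))
      ... | inj₂ (_ , e₁) | inj₂ (_ , e₂) rewrite e₁ | e₂ = same (v x) (v y)
        where
        same₀ : ∀ a b m → a - b ≡ a - m * 1ℚ - (b - m * 1ℚ)
        same₀ = solve-∀ ℚ-ring
        same : ∀ a b → ∣ a - b ∣ ≡ ∣ a - m * 1ℚ - (b - m * 1ℚ) ∣ + m * 0ℚ
        same a b = trans (cong ∣_∣ (same₀ a b m)) (sym (p+m*0 _))
      ... | inj₂ (m≤v , e₁) | inj₁ (v≡0 , e₂) rewrite e₁ | e₂ | v≡0 =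
        trans (trans (cong ∣_∣ (drop (v x))) (0≤p⇒∣p∣≡p (0≤v x∈)))
          (trans (rejoin (v x) m) (cong (_+ m * 1ℚ) (sym (trans (cong ∣_∣ (drop₂ (v x) m)) (0≤p⇒∣p∣≡p (p≤q⇒0≤q-p m≤v))))))
        where
        drop : ∀ a → a - 0ℚ ≡ a
        drop = solve-∀ ℚ-ring
        drop₂ : ∀ a m → a - m * 1ℚ - (0ℚ - m * 0ℚ) ≡ a - m
        drop₂ = solve-∀ ℚ-ring
        rejoin : ∀ a m → a ≡ a - m + m * 1ℚ
        rejoin = solve-∀ ℚ-ring
      ... | inj₁ (v≡0 , e₁) | inj₂ (m≤v , e₂) rewrite e₁ | e₂ | v≡0 =
        trans (trans (cong ∣_∣ (drop (v y))) (trans (∣-p∣≡∣p∣ (v y)) (0≤p⇒∣p∣≡p (0≤v y∈))))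
          (trans (rejoin (v y) m) (cong (_+ m * 1ℚ) (sym (trans (cong ∣_∣ (drop₂ (v y) m)) (trans (∣-p∣≡∣p∣ (v y - m)) (0≤p⇒∣p∣≡p (p≤q⇒0≤q-p m≤v)))))))
        where
        drop : ∀ a → 0ℚ - a ≡ - a
        drop = solve-∀ ℚ-ring
        drop₂ : ∀ a m → 0ℚ - m * 0ℚ - (a - m * 1ℚ) ≡ - (a - m)
        drop₂ = solve-∀ ℚ-ring
        rejoin : ∀ a m → a ≡ a - m + m * 1ℚ
        rejoin = solve-∀ ℚ-ring

      0≤v′ : ∀ {x} → x ∈ V → 0ℚ ≤ v′ x
      0≤v′ {x} x∈ with level x∈
      ... | inj₁ (v≡0 , e) rewrite e | v≡0 | *-zeroʳ m = ≤-refl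
      ... | inj₂ (m≤v , e) rewrite e | *-identityʳ m = p≤q⇒0≤q-p m≤v

      v′≤v : ∀ x → v′ x ≤ v x
      v′≤v x = ≤-by-gap _ (gap (v x) (m * χ (W x))) (0≤* (<⇒≤ 0<m) (0≤χ (W x)))
        where
        gap : ∀ a b → a - (a - b) ≡ b
        gap = solve-∀ ℚ-ring

      pos? : ∀ x → Dec (0ℚ < v′ x)
      pos? x = 0ℚ <? v′ x

      L′ : List A
      L′ = filter pos? L

      v′a≮ : ¬ 0ℚ < v′ a
      v′a≮ 0<v′a = <-irrefl refl (subst (0ℚ <_) v′a≡0 0<v′a)
        where
        v′a≡0 : v′ a ≡ 0ℚ
        v′a≡0 = trans (cong (λ c → m - m * c) (<⇒χ≡1 0<m)) (trans (cong (λ c → m - c) (*-identityʳ m)) (+-inverseʳ m))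

      rec : (h + h) * ∑ V (λ x → D x * v′ x) ≤ variation v′
      -- The minimiser `a` drops to zero and leaves the support, so the list gets strictly shorter
      -- and `n` units of fuel suffice. The new support lies inside the old one, hence still has at
      -- most half the volume.
      rec = coarea-fuel n v′ L′
        (ℕₚ.≤-trans (ℕ.s≤s⁻¹ (filter-notAll pos? L (lose a∈L v′a≮))) |L|≤n)
        0≤v′
        (λ {x} x∈ 0<v′ → ∈-filter⁺ pos? (supp⊆L x∈ (<-≤-trans 0<v′ (v′≤v x))) 0<v′)
        (λ x∈L′ → let x∈L , 0<v′ = ∈-filter⁻ pos? {xs = L} x∈L′ in proj₁ (L⊆supp x∈L) , 0<v′)
        (≤-trans (vol-mono λ {x} _ e → dec-true (0ℚ <? v x) (<-≤-trans (<ᵇ-sound e) (v′≤v x))) small)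

    coarea : ∀ (v : A → ℚ) → (∀ {x} → x ∈ V → 0ℚ ≤ v x) →
      vol (λ x → 0ℚ <ᵇ v x) ≤ ½ * total →
      (h + h) * ∑ V (λ x → D x * v x) ≤ variation v
    coarea v 0≤v = coarea-fuel _ v (filter pos? V) ℕₚ.≤-refl 0≤v (∈-filter⁺ pos?) (∈-filter⁻ pos?)
      where
      pos? : ∀ x → Dec (0ℚ < v x)
      pos? x = 0ℚ <? v x

    -- The coarea bound for `u²` gives `2h² normD u` from below, and `young` gives
    -- `energy u + h² normD u` from above, each pair contributing both of its endpoints to `normD`.
    -- One copy of `h² normD u` cancels.
    h²·normD≤energy-small : ∀ (u : A → ℚ) → vol (λ x → 0ℚ <ᵇ (u x * u x)) ≤ ½ * total →
      h * h * normD u ≤ energy u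
    h²·normD≤energy-small u small = 0≤q-p⇒p≤q (subst (0ℚ ≤_) (cancel (energy u) (h * h) (normD u)) (p≤q⇒0≤q-p chain))
      where
      open ≤-Reasoning
      u² : A → ℚ
      u² x = u x * u x
      cancel : ∀ e k n → e + ½ * k * (n + n) - (k * n + k * n) ≡ e - k * n
      cancel = solve-∀ ℚ-ring
      double : ∀ h n → h * h * n + h * h * n ≡ h * ((h + h) * n)
      double = solve-∀ ℚ-ring
      chain : h * h * normD u + h * h * normD u ≤ energy u + ½ * (h * h) * (normD u + normD u)
      chain = begin
        h * h * normD u + h * h * normD u
          ≡⟨ double h (normD u) ⟩
        h * ((h + h) * normD u)
          ≤⟨ *-monoˡ-≤ h 0≤h (coarea u² (λ {x} _ → 0≤p² (u x)) small) ⟩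
        h * variation u²
          ≡⟨ ∑∑-*ˡ h _ ⟨
        ∑∑ (λ x y → h * ∣ u² x - u² y ∣)
          ≤⟨ ∑∑-mono (λ {x} {y} _ _ → young h (u x) (u y)) ⟩
        ∑∑ (λ x y → (u x - u y) * (u x - u y) + ½ * (h * h) * (u² x + u² y))
          ≡⟨ ∑∑-+ _ _ ⟩
        energy u + ∑∑ (λ x y → ½ * (h * h) * (u² x + u² y))
          ≡⟨ cong (energy u +_) (trans (∑∑-*ˡ (½ * (h * h)) (λ x y → u² x + u² y)) (cong (½ * (h * h) *_) (trans (∑∑-+ _ _) (cong₂ _+_ (∑∑-left _) (∑∑-right _))))) ⟩
        energy u + ½ * (h * h) * (normD u + normD u) ∎

    -- Subtracting a median `c` does not change the energy. Since `f` is orthogonal to constants, it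
    -- raises `normD` by `c²` times the total weight, so the estimate may be proved for the shifted
    -- function. Its positive and negative parts are supported in `c < f` and `f < c`, to which the
    -- case of small support applies.
    h²·normD≤energy : ∀ (f : A → ℚ) → ∑ V (λ x → D x * f x) ≡ 0ℚ → h * h * normD f ≤ energy f
    h²·normD≤energy f f⊥1 with ∃-median f
    ... | c , below , above = begin
      h * h * normD f
        ≤⟨ *-monoˡ-≤ (h * h) (0≤p² h) normD-shift ⟩
      h * h * normD g
        ≡⟨ cong (h * h *_) (trans (∑-cong V λ {x} _ → trans (cong (D x *_) (sym (posneg-² (g x)))) (*-distribˡ-+ (D x) _ _)) (∑-+ V _ _)) ⟩
      h * h * (normD g⁺ + normD g⁻)
        ≡⟨ *-distribˡ-+ (h * h) (normD g⁺) (normD g⁻) ⟩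
      h * h * normD g⁺ + h * h * normD g⁻
        ≤⟨ +-mono-≤ (h²·normD≤energy-small g⁺ (≤-trans (vol-mono supp⁺) above)) (h²·normD≤energy-small g⁻ (≤-trans (vol-mono supp⁻) below)) ⟩
      energy g⁺ + energy g⁻
        ≡⟨ ∑∑-+ _ _ ⟨
      ∑∑ (λ x y → (g⁺ x - g⁺ y) * (g⁺ x - g⁺ y) + (g⁻ x - g⁻ y) * (g⁻ x - g⁻ y))
        ≤⟨ ∑∑-mono (λ {x} {y} _ _ → posneg-contract (g x) (g y)) ⟩
      energy g
        ≡⟨ ∑∑-cong (λ {x} {y} _ _ → unshift (f x) (f y) c) ⟩
      energy f ∎
      where
      open ≤-Reasoning
      g g⁺ g⁻ : A → ℚ
      g x  = f x - c
      g⁺ x = (g x) ⁺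
      g⁻ x = (- g x) ⁺

      unshift : ∀ a b c → (a - c - (b - c)) * (a - c - (b - c)) ≡ (a - b) * (a - b)
      unshift = solve-∀ ℚ-ring

      normD-shift : normD f ≤ normD g
      normD-shift = ≤-by-gap (∑ V λ x → D x * (c * c)) gap (0≤∑ V λ {x} _ → 0≤* (0≤D x) (0≤p² c))
        where
        pointwise : ∀ d f c → d * ((f - c) * (f - c)) ≡ d * (f * f) + d * (c * c) + (- 1ℚ - 1ℚ) * c * (d * f)
        pointwise = solve-∀ ℚ-ring
        collect : ∀ n m k → n + m + k * 0ℚ - n ≡ m
        collect = solve-∀ ℚ-ring
        gap : normD g - normD f ≡ ∑ V λ x → D x * (c * c)
        gap = trans (cong (_- normD f) (trans (∑-cong V λ {x} _ → pointwise (D x) (f x) c)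
            (trans (∑-+ V _ _) (cong₂ _+_ (∑-+ V (λ x → D x * (f x * f x)) (λ x → D x * (c * c)))
              (trans (∑-*ˡ V ((- 1ℚ - 1ℚ) * c) (λ x → D x * f x)) (cong ((- 1ℚ - 1ℚ) * c *_) f⊥1))))))
          (collect (normD f) (∑ V λ x → D x * (c * c)) ((- 1ℚ - 1ℚ) * c))

      p⁺²>0⇒p>0 : ∀ p → 0ℚ < p ⁺ * p ⁺ → 0ℚ < p
      p⁺²>0⇒p>0 p 0<p² with 0ℚ <? p
      ... | yes 0<p = 0<p
      ... | no  0≮p = contradiction (subst (λ q → 0ℚ < q * q) (p≤q⇒p⊔q≡q (≮⇒≥ 0≮p)) 0<p²) (<-irrefl refl)

      supp⁺ : ∀ {x} → x ∈ V → 0ℚ <ᵇ (g⁺ x * g⁺ x) ≡ true → c <ᵇ f x ≡ true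
      supp⁺ {x} _ e = dec-true (c <? f x) (subst₂ _<_ (+-identityˡ c) (cancel (f x) c) (+-monoˡ-< c (p⁺²>0⇒p>0 (g x) (<ᵇ-sound e))))
        where
        cancel : ∀ a c → a - c + c ≡ a
        cancel = solve-∀ ℚ-ring

      supp⁻ : ∀ {x} → x ∈ V → 0ℚ <ᵇ (g⁻ x * g⁻ x) ≡ true → f x <ᵇ c ≡ true
      supp⁻ {x} _ e = dec-true (f x <? c) (subst₂ _<_ (+-identityˡ (f x)) (cancel (f x) c) (+-monoˡ-< (f x) (p⁺²>0⇒p>0 (- g x) (<ᵇ-sound e))))
        where
        cancel : ∀ a c → - (a - c) + a ≡ c
        cancel = solve-∀ ℚ-ring

    form≤ : ∀ (f : A → ℚ) → ∑ V (λ x → D x * f x) ≡ 0ℚ → form f f ≤ (1ℚ - ½ * (h * h)) * normD f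
    form≤ f f⊥1 = ≤-by-gap _ (gap (normD f) (form f f) (h * h)) (0≤* 0≤½ (p≤q⇒0≤q-p
      (subst (h * h * normD f ≤_) (energy-form f) (h²·normD≤energy f f⊥1))))
      where
      gap : ∀ n q k → (1ℚ - ½ * k) * n - q ≡ ½ * (n + n - (q + q) - k * n)
      gap = solve-∀ ℚ-ring

  form-expand : ∀ a b f g → form (λ x → a * f x + b * g x) (λ x → a * f x + b * g x)
    ≡ a * a * form f f + (a * b + a * b) * form f g + b * b * form g g
  form-expand a b f g = begin
    form (λ x → a * f x + b * g x) (λ x → a * f x + b * g x)
      ≡⟨ ∑∑-cong (λ {x} {y} _ _ → expand a b (f x) (f y) (g x) (g y)) ⟩
    ∑∑ (λ x y → a * a * (f x * f y) + (a * b * (f x * g y) + a * b * (g x * f y)) + b * b * (g x * g y))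
      ≡⟨ trans (∑∑-+ _ _) (cong₂ _+_ (trans (∑∑-+ _ _) (cong₂ _+_
           (∑∑-*ˡ (a * a) (λ x y → f x * f y))
           (trans (∑∑-+ _ _) (cong₂ _+_ (∑∑-*ˡ (a * b) (λ x y → f x * g y)) (∑∑-*ˡ (a * b) (λ x y → g x * f y))))))
           (∑∑-*ˡ (b * b) (λ x y → g x * g y))) ⟩
    a * a * form f f + (a * b * form f g + a * b * form g f) + b * b * form g g
      ≡⟨ cong (λ q → a * a * form f f + (a * b * form f g + a * b * q) + b * b * form g g) (form-sym g f) ⟩
    a * a * form f f + (a * b * form f g + a * b * form f g) + b * b * form g g
      ≡⟨ cong (λ q → a * a * form f f + q + b * b * form g g) (sym (*-distribʳ-+ (form f g) (a * b) (a * b))) ⟩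
    a * a * form f f + (a * b + a * b) * form f g + b * b * form g g ∎
    where
    open ≡-Reasoning
    expand : ∀ a b p q r s → (a * p + b * r) * (a * q + b * s)
      ≡ a * a * (p * q) + (a * b * (p * s) + a * b * (r * q)) + b * b * (r * s)
    expand = solve-∀ ℚ-ring

  normD-expand : ∀ a b f g → normD (λ x → a * f x + b * g x)
    ≡ a * a * normD f + (a * b + a * b) * ∑ V (λ x → D x * (f x * g x)) + b * b * normD g
  normD-expand a b f g = trans (∑-cong V λ {x} _ → expand (D x) a b (f x) (g x))
    (trans (∑-+ V _ _) (cong₂ _+_ (trans (∑-+ V _ _) (cong₂ _+_
      (∑-*ˡ V (a * a) (λ x → D x * (f x * f x)))
      (∑-*ˡ V (a * b + a * b) (λ x → D x * (f x * g x)))))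
      (∑-*ˡ V (b * b) (λ x → D x * (g x * g x)))))
    where
    expand : ∀ d a b p q → d * ((a * p + b * q) * (a * p + b * q))
      ≡ a * a * (d * (p * p)) + (a * b + a * b) * (d * (p * q)) + b * b * (d * (q * q))
    expand = solve-∀ ℚ-ring

  ∑D-expand : ∀ a b (f g : A → ℚ) → ∑ V (λ x → D x * (a * f x + b * g x)) ≡ a * ∑ V (λ x → D x * f x) + b * ∑ V (λ x → D x * g x)
  ∑D-expand a b f g = trans (∑-cong V λ {x} _ → expand (D x) a b (f x) (g x))
    (trans (∑-+ V _ _) (cong₂ _+_ (∑-*ˡ V a _) (∑-*ˡ V b _)))
    where
    expand : ∀ d a b p q → d * (a * p + b * q) ≡ a * (d * p) + b * (d * q)
    expand = solve-∀ ℚ-ring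

  -- From two-sided form bounds to contraction and ℓ² mixing.

  module RandomWalk (r : A → ℚ) (0≤r : ∀ x → 0ℚ ≤ r x) (D*r : ∀ {x} → x ∈ V → D x * r x ≡ 1ℚ)
    (μ : ℚ) (0<μ : 0ℚ < μ)
    (form-upper : ∀ f → ∑ V (λ x → D x * f x) ≡ 0ℚ → form f f ≤ μ * normD f)
    (form-lower : ∀ f → ∑ V (λ x → D x * f x) ≡ 0ℚ → - (μ * normD f) ≤ form f f) where

    stepᵣ : (A → ℚ) → A → ℚ
    stepᵣ z y = ∑ V λ x → z x * (w x y * r x)

    -- The squared norm of a signed measure with inverse degrees as weights; it is `normD` of the
    -- density `z x * r x`.
    norm⁻ : (A → ℚ) → ℚ
    norm⁻ z = ∑ V λ x → z x * z x * r x

    module _ (z : A → ℚ) where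
      private
        f g k : A → ℚ
        f x = z x * r x
        g   = stepᵣ z
        k x = g x * r x

      D*z*r : ∀ (u : A → ℚ) {x} → x ∈ V → D x * (u x * r x) ≡ u x
      D*z*r u {x} x∈ = trans (shuffle (D x) (u x) (r x)) (trans (cong (u x *_) (D*r x∈)) (*-identityʳ (u x)))
        where
        shuffle : ∀ d u r → d * (u * r) ≡ u * (d * r)
        shuffle = solve-∀ ℚ-ring

      normD≡norm⁻ : ∀ (u : A → ℚ) → normD (λ x → u x * r x) ≡ norm⁻ u
      normD≡norm⁻ u = ∑-cong V λ {x} x∈ → trans (shuffle (D x) (u x) (r x)) (cong (λ q → q * u x * r x) (D*z*r u x∈))
        where
        shuffle : ∀ d u r → d * (u * r * (u * r)) ≡ d * (u * r) * u * r
        shuffle = solve-∀ ℚ-ring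

      g≡ : ∀ y → g y ≡ ∑ V λ x → w x y * f x
      g≡ y = ∑-cong V λ {x} _ → shuffle (z x) (w x y) (r x)
        where
        shuffle : ∀ z w r → z * (w * r) ≡ w * (z * r)
        shuffle = solve-∀ ℚ-ring

      ∑-stepᵣ : ∑ V (stepᵣ z) ≡ ∑ V z
      ∑-stepᵣ = trans (∑-cong V λ {y} _ → g≡ y) (trans (sym (∑-swap V V _)) (trans (∑∑-left f) (∑-cong V (D*z*r z))))

      -- Summing over the source vertex first turns `f` into one step of the walk, so the mixed term
      -- of the polarisation is precisely the norm to be bounded.
      form-f-k : form f k ≡ norm⁻ g
      form-f-k = trans (∑-swap V V _) (∑-cong V λ {y} _ → trans
        (trans (∑-cong V λ {x} _ → sym (*-assoc (w x y) (f x) (k y))) (∑-*ʳ V (k y) (λ x → w x y * f x)))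
        (trans (cong (_* k y) (sym (g≡ y))) (sym (*-assoc (g y) (g y) (r y)))))

      -- Polarisation at μf ± k turns the bound on |⟨f, Pf⟩| into a bound on ⟨Pf, Pf⟩.
      norm⁻-contract : ∑ V z ≡ 0ℚ → norm⁻ (stepᵣ z) ≤ μ * μ * norm⁻ z
      norm⁻-contract ∑z≡0 = *-cancelˡ-≤ (μ + μ) (+-mono-< 0<μ 0<μ) (≤-by-gap _ gap
        (0≤+ (p≤q⇒0≤q-p upper) (p≤q⇒0≤q-p lower)))
        where
        F K Q₁ Q₂ C : ℚ
        F  = norm⁻ z
        K  = norm⁻ g
        Q₁ = form f f
        Q₂ = form k k
        C  = ∑ V (λ x → D x * (f x * k x))
        ∑Df : ∑ V (λ x → D x * f x) ≡ 0ℚ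
        ∑Df = trans (∑-cong V (D*z*r z)) ∑z≡0
        ∑Dk : ∑ V (λ x → D x * k x) ≡ 0ℚ
        ∑Dk = trans (∑-cong V (D*z*r g)) (trans ∑-stepᵣ ∑z≡0)
        orth : ∀ b → ∑ V (λ x → D x * (μ * f x + b * k x)) ≡ 0ℚ
        orth b = trans (∑D-expand μ b f k) (trans (cong₂ (λ p q → μ * p + b * q) ∑Df ∑Dk) (zeros μ b))
          where
          zeros : ∀ a b → a * 0ℚ + b * 0ℚ ≡ 0ℚ
          zeros = solve-∀ ℚ-ring
        form-eq : ∀ b → form (λ x → μ * f x + b * k x) (λ x → μ * f x + b * k x) ≡ μ * μ * Q₁ + (μ * b + μ * b) * K + b * b * Q₂
        form-eq b = trans (form-expand μ b f k) (cong (λ q → μ * μ * Q₁ + (μ * b + μ * b) * q + b * b * Q₂) form-f-k)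
        normD-eq : ∀ b → normD (λ x → μ * f x + b * k x) ≡ μ * μ * F + (μ * b + μ * b) * C + b * b * K
        normD-eq b = trans (normD-expand μ b f k) (cong₂ (λ p q → μ * μ * p + (μ * b + μ * b) * C + b * b * q) (normD≡norm⁻ z) (normD≡norm⁻ g))
        upper : μ * μ * Q₁ + (μ * 1ℚ + μ * 1ℚ) * K + 1ℚ * 1ℚ * Q₂ ≤ μ * (μ * μ * F + (μ * 1ℚ + μ * 1ℚ) * C + 1ℚ * 1ℚ * K)
        upper = subst₂ (λ p q → p ≤ μ * q) (form-eq 1ℚ) (normD-eq 1ℚ) (form-upper _ (orth 1ℚ))
        lower : - (μ * (μ * μ * F + (μ * - 1ℚ + μ * - 1ℚ) * C + - 1ℚ * - 1ℚ * K)) ≤ μ * μ * Q₁ + (μ * - 1ℚ + μ * - 1ℚ) * K + - 1ℚ * - 1ℚ * Q₂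
        lower = subst₂ (λ p q → - (μ * q) ≤ p) (form-eq (- 1ℚ)) (normD-eq (- 1ℚ)) (form-lower _ (orth (- 1ℚ)))
        -- Taking the upper bound at `μf + k` and the lower bound at `μf - k` cancels `Q₁`, `Q₂` and
        -- `C`. What remains is `2μ³F + 2μK - 4μK`, that is `2μ(μ²F - K)`.
        gap : (μ + μ) * (μ * μ * F) - (μ + μ) * K
          ≡ μ * (μ * μ * F + (μ * 1ℚ + μ * 1ℚ) * C + 1ℚ * 1ℚ * K) - (μ * μ * Q₁ + (μ * 1ℚ + μ * 1ℚ) * K + 1ℚ * 1ℚ * Q₂)
          + (μ * μ * Q₁ + (μ * - 1ℚ + μ * - 1ℚ) * K + - 1ℚ * - 1ℚ * Q₂ - - (μ * (μ * μ * F + (μ * - 1ℚ + μ * - 1ℚ) * C + - 1ℚ * - 1ℚ * K)))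
        gap = identity μ F K Q₁ Q₂ C
          where
          identity : ∀ μ F K Q₁ Q₂ C → (μ + μ) * (μ * μ * F) - (μ + μ) * K
            ≡ μ * (μ * μ * F + (μ * 1ℚ + μ * 1ℚ) * C + 1ℚ * 1ℚ * K) - (μ * μ * Q₁ + (μ * 1ℚ + μ * 1ℚ) * K + 1ℚ * 1ℚ * Q₂)
            + (μ * μ * Q₁ + (μ * - 1ℚ + μ * - 1ℚ) * K + - 1ℚ * - 1ℚ * Q₂ - - (μ * (μ * μ * F + (μ * - 1ℚ + μ * - 1ℚ) * C + - 1ℚ * - 1ℚ * K)))
          identity = solve-∀ ℚ-ring

    module _ (ρ : ℚ) (ρ*total : ρ * total ≡ 1ℚ)
      (π₀ : A → ℚ) (0≤π₀ : ∀ {x} → x ∈ V → 0ℚ ≤ π₀ x) (∑π₀ : ∑ V π₀ ≡ 1ℚ)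
      (walkᵣ : ℕ → A → ℚ) (walk-zero : ∀ x → walkᵣ zero x ≡ π₀ x) (walk-suc : ∀ t x → walkᵣ (suc t) x ≡ stepᵣ (walkᵣ t) x)
      (dᵐᵃˣ R : ℚ) (0≤dᵐᵃˣ : 0ℚ ≤ dᵐᵃˣ)
      (D≤dᵐᵃˣ : ∀ {x} → x ∈ V → D x ≤ dᵐᵃˣ) (0≤R : 0ℚ ≤ R) (r≤R : ∀ {x} → x ∈ V → r x ≤ R) where

      π : A → ℚ
      π x = ρ * D x

      deviation : ℕ → A → ℚ
      deviation t x = walkᵣ t x - π x

      -- Detailed balance: `D x` cancels the reciprocal `r x`, and symmetry of `w` turns the
      -- remaining sum into `D y`.
      stepᵣ-π : ∀ y → stepᵣ π y ≡ π y
      stepᵣ-π y = trans (∑-cong V λ {x} x∈ → trans (shuffle ρ (D x) (w x y) (r x))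
          (trans (cong₂ (λ p q → ρ * p * q) (w-sym x y) (D*r x∈)) (*-identityʳ _)))
        (∑-*ˡ V ρ (w y))
        where
        shuffle : ∀ ρ d w r → ρ * d * (w * r) ≡ ρ * w * (d * r)
        shuffle = solve-∀ ℚ-ring

      deviation-suc : ∀ t y → deviation (suc t) y ≡ stepᵣ (deviation t) y
      deviation-suc t y = sym (trans
        (trans (∑-cong V λ {x} _ → *-distribʳ-- (w x y * r x) (walkᵣ t x) (π x)) (∑-- V _ _))
        (cong₂ _-_ (sym (walk-suc t y)) (stepᵣ-π y)))
        where
        *-distribʳ-- : ∀ c a b → (a - b) * c ≡ a * c - b * c
        *-distribʳ-- = solve-∀ ℚ-ring

      ∑π : ∑ V π ≡ 1ℚ
      ∑π = trans (∑-*ˡ V ρ D) ρ*total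

      ∑-deviation : ∀ t → ∑ V (deviation t) ≡ 0ℚ
      ∑-deviation zero = trans (∑-- V _ _) (trans (cong₂ _-_ (trans (∑-cong V λ {x} _ → walk-zero x) ∑π₀) ∑π) (+-inverseʳ 1ℚ))
      ∑-deviation (suc t) = trans (∑-cong V λ {y} _ → deviation-suc t y) (trans (∑-stepᵣ (deviation t)) (∑-deviation t))

      -- Pythagoras: the density of `π` is the constant `ρ` on `V`, so removing `π` from a
      -- probability measure lowers the squared norm by exactly `ρ`. What is left is at most `R`
      -- times the sum of squares of a probability vector, which is at most 1.
      norm⁻-deviation-zero : norm⁻ (deviation zero) ≤ R
      norm⁻-deviation-zero = begin
        norm⁻ (deviation zero)
          ≤⟨ ≤-by-gap _ gap 0≤ρ ⟩
        norm⁻ π₀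
          ≤⟨ ∑-mono V (λ {x} x∈ → *-monoˡ-≤ (π₀ x * π₀ x) (0≤p² (π₀ x)) (r≤R x∈)) ⟩
        ∑ V (λ x → π₀ x * π₀ x * R)
          ≡⟨ trans (∑-*ʳ V R _) (*-comm _ R) ⟩
        R * ∑ V (λ x → π₀ x * π₀ x)
          ≤⟨ *-monoˡ-≤ R 0≤R (∑²≤[∑]² V 0≤π₀) ⟩
        R * (∑ V π₀ * ∑ V π₀)
          ≡⟨ cong (λ q → R * (q * q)) ∑π₀ ⟩
        R * (1ℚ * 1ℚ)
          ≡⟨ *-identityʳ R ⟩
        R ∎
        where
        open ≤-Reasoning
        0≤ρ : 0ℚ ≤ ρ
        0≤ρ = subst (0ℚ ≤_) (trans (shuffle ρ total) (trans (cong (_* ρ) ρ*total) (*-identityˡ ρ)))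
          (0≤* (0≤p² ρ) (0≤∑ V (λ {x} _ → 0≤D x)))
          where
          shuffle : ∀ ρ t → ρ * ρ * t ≡ ρ * t * ρ
          shuffle = solve-∀ ℚ-ring
        pointwise : ∀ p ρ d r → p * p * r - (p - ρ * d) * (p - ρ * d) * r ≡ ρ * ((d * r) * (p + p - ρ * d))
        pointwise = solve-∀ ℚ-ring
        gap : norm⁻ π₀ - norm⁻ (deviation zero) ≡ ρ
        gap = trans (sym (∑-- V _ _)) (trans (∑-cong V λ {x} x∈ → trans
              (cong (λ p → π₀ x * π₀ x * r x - (p - π x) * (p - π x) * r x) (walk-zero x))
              (trans (pointwise (π₀ x) ρ (D x) (r x)) (cong (λ q → ρ * (q * (π₀ x + π₀ x - π x))) (D*r x∈))))
            (trans (∑-*ˡ V ρ _) (trans (cong (ρ *_) (trans (∑-cong V λ {x} _ → *-identityˡ _) (trans (∑-- V _ π)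
              (cong₂ _-_ (trans (∑-+ V π₀ π₀) (cong₂ _+_ ∑π₀ ∑π₀)) ∑π)))) (*-identityʳ ρ))))

      norm⁻-deviation : ∀ t → norm⁻ (deviation t) ≤ R * ((μ ^ℚ t) * (μ ^ℚ t))
      norm⁻-deviation zero = subst (norm⁻ (deviation zero) ≤_) (sym (*-identityʳ R)) norm⁻-deviation-zero
      norm⁻-deviation (suc t) = begin
        norm⁻ (deviation (suc t))
          ≡⟨ ∑-cong V (λ {x} _ → cong (λ q → q * q * r x) (deviation-suc t x)) ⟩
        norm⁻ (stepᵣ (deviation t))
          ≤⟨ norm⁻-contract (deviation t) (∑-deviation t) ⟩
        μ * μ * norm⁻ (deviation t)
          ≤⟨ *-monoˡ-≤ (μ * μ) (0≤p² μ) (norm⁻-deviation t) ⟩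
        μ * μ * (R * ((μ ^ℚ t) * (μ ^ℚ t)))
          ≡⟨ shuffle μ R (μ ^ℚ t) ⟩
        R * ((μ ^ℚ suc t) * (μ ^ℚ suc t)) ∎
        where
        open ≤-Reasoning
        shuffle : ∀ m R p → m * m * (R * (p * p)) ≡ R * (m * p * (m * p))
        shuffle = solve-∀ ℚ-ring

      -- Inserting `D x * r x`, which is 1 on `V`, and bounding `D x` by its maximum replaces the
      -- plain norm by the weighted one, for which the decay is known.
      ℓ²-mixing : ∀ t → ∑ V (λ x → deviation t x * deviation t x) ≤ dᵐᵃˣ * R * ((μ ^ℚ t) * (μ ^ℚ t))
      ℓ²-mixing t = begin
        ∑ V (λ x → deviation t x * deviation t x)
          ≡⟨ ∑-cong V (λ {x} x∈ → trans (sym (*-identityʳ _)) (trans (cong (z x * z x *_) (sym (D*r x∈))) (shuffle (z x) (D x) (r x)))) ⟩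
        ∑ V (λ x → z x * z x * r x * D x)
          ≤⟨ ∑-mono V (λ {x} x∈ → *-monoˡ-≤ (z x * z x * r x) (0≤* (0≤p² (z x)) (0≤r x)) (D≤dᵐᵃˣ x∈)) ⟩
        ∑ V (λ x → z x * z x * r x * dᵐᵃˣ)
          ≡⟨ trans (∑-*ʳ V dᵐᵃˣ _) (*-comm _ dᵐᵃˣ) ⟩
        dᵐᵃˣ * norm⁻ z
          ≤⟨ *-monoˡ-≤ dᵐᵃˣ 0≤dᵐᵃˣ (norm⁻-deviation t) ⟩
        dᵐᵃˣ * (R * ((μ ^ℚ t) * (μ ^ℚ t)))
          ≡⟨ *-assoc dᵐᵃˣ R _ ⟨
        dᵐᵃˣ * R * ((μ ^ℚ t) * (μ ^ℚ t)) ∎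
        where
        open ≤-Reasoning
        z : A → ℚ
        z = deviation t
        shuffle : ∀ z d r → z * z * (d * r) ≡ z * z * r * d
        shuffle = solve-∀ ℚ-ring

-- Casting ℕ to ℚ

-- The recursion makes `ι (suc n)` unfold to `1ℚ + ι n`, a shape that ring identities can use
-- directly; `ι≡/1` identifies it with the normalised fraction.
ι : ℕ → ℚ
ι zero    = 0ℚ
ι (suc n) = 1ℚ + ι n

ι-+ : ∀ m n → ι (m ℕ.+ n) ≡ ι m + ι n
ι-+ zero    n = sym (+-identityˡ (ι n))
ι-+ (suc m) n = trans (cong (1ℚ +_) (ι-+ m n)) (sym (+-assoc 1ℚ (ι m) (ι n)))

ι-* : ∀ m n → ι (m ℕ.* n) ≡ ι m * ι n
ι-* zero    n = sym (*-zeroˡ (ι n))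
ι-* (suc m) n = trans (ι-+ n (m ℕ.* n)) (trans (cong (ι n +_) (ι-* m n)) (expand (ι m) (ι n)))
  where
  expand : ∀ a b → b + a * b ≡ (1ℚ + a) * b
  expand = solve-∀ ℚ-ring

0≤ι : ∀ n → 0ℚ ≤ ι n
0≤ι zero    = ≤-refl
0≤ι (suc n) = 0≤+ 0≤1 (0≤ι n)

0<ι : ∀ {n} → 0 ℕ.< n → 0ℚ < ι n
0<ι {suc n} _ = +-mono-<-≤ (positive⁻¹ 1ℚ) (0≤ι n)

0<ι⁻¹ : ∀ {n} → 0ℚ < ι n → 0 ℕ.< n
0<ι⁻¹ {zero}  0<0 = contradiction 0<0 (<-irrefl refl)
0<ι⁻¹ {suc n} _   = ℕ.s≤s ℕ.z≤n

ι-mono : ∀ {m n} → m ℕ.≤ n → ι m ≤ ι n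
ι-mono {n = n} ℕ.z≤n = 0≤ι n
ι-mono (ℕ.s≤s m≤n) = +-monoʳ-≤ 1ℚ (ι-mono m≤n)

toℚᵘ-/ : ∀ a b → toℚᵘ (ℤ.+ a / suc b) ℚᵘ.≃ ℚᵘ.mkℚᵘ (ℤ.+ a) b
toℚᵘ-/ a b = toℚᵘ-fromℚᵘ (ℚᵘ.mkℚᵘ (ℤ.+ a) b)

ι≡/1 : ∀ n → ι n ≡ ℤ.+ n / 1
ι≡/1 zero    = refl
ι≡/1 (suc n) = trans (cong (1ℚ +_) (ι≡/1 n)) (toℚᵘ-injective (begin
  toℚᵘ (1ℚ + ℤ.+ n / 1)               ≈⟨ toℚᵘ-homo-+ 1ℚ (ℤ.+ n / 1) ⟩
  toℚᵘ 1ℚ ℚᵘ.+ toℚᵘ (ℤ.+ n / 1)       ≈⟨ ℚᵘₚ.+-congʳ (toℚᵘ 1ℚ) (toℚᵘ-/ n 0) ⟩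
  ℚᵘ.1ℚᵘ ℚᵘ.+ ℚᵘ.mkℚᵘ (ℤ.+ n) 0       ≈⟨ ℚᵘ.*≡* (cong (ℤ._* (ℤ.+ 1)) (cong (λ m → ℤ.+ 1 ℤ.+ m) (ℤₚ.*-identityʳ (ℤ.+ n)))) ⟩
  ℚᵘ.mkℚᵘ (ℤ.+ suc n) 0               ≈⟨ toℚᵘ-/ (suc n) 0 ⟨
  toℚᵘ (ℤ.+ suc n / 1)                ∎))
  where open ℚᵘₚ.≃-Reasoning

frac-*ι : ∀ a {b} → 0 ℕ.< b → frac a b * ι b ≡ ι a
frac-*ι a {suc b} _ = trans (cong (frac a (suc b) *_) (ι≡/1 (suc b))) (trans (toℚᵘ-injective (begin
  toℚᵘ (ℤ.+ a / suc b * (ℤ.+ suc b / 1))              ≈⟨ toℚᵘ-homo-* (ℤ.+ a / suc b) (ℤ.+ suc b / 1) ⟩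
  toℚᵘ (ℤ.+ a / suc b) ℚᵘ.* toℚᵘ (ℤ.+ suc b / 1)      ≈⟨ ℚᵘₚ.*-cong (toℚᵘ-/ a b) (toℚᵘ-/ (suc b) 0) ⟩
  ℚᵘ.mkℚᵘ (ℤ.+ a) b ℚᵘ.* ℚᵘ.mkℚᵘ (ℤ.+ suc b) 0        ≈⟨ ℚᵘ.*≡* (trans (ℤₚ.*-identityʳ _) (cong (λ c → ℤ.+ a ℤ.* ℤ.+ suc c) (sym (ℕₚ.*-identityʳ b)))) ⟩
  ℚᵘ.mkℚᵘ (ℤ.+ a) 0                                 ≈⟨ toℚᵘ-/ a 0 ⟨
  toℚᵘ (ℤ.+ a / 1)                                  ∎)) (sym (ι≡/1 a)))
  where open ℚᵘₚ.≃-Reasoning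

frac1-*ι : ∀ {b} → 0 ℕ.< b → frac 1 b * ι b ≡ 1ℚ
frac1-*ι 0<b = trans (frac-*ι 1 0<b) (+-identityʳ 1ℚ)

-- For denominator zero both sides take the default value 0, so transition probabilities can be
-- rewritten at every set, without a case distinction on its degree.
frac≡ι*frac1 : ∀ a b → frac a b ≡ ι a * frac 1 b
frac≡ι*frac1 a zero = sym (*-zeroʳ (ι a))
frac≡ι*frac1 a b@(suc _) = begin
  frac a b                        ≡⟨ *-identityʳ (frac a b) ⟨
  frac a b * 1ℚ                   ≡⟨ cong (frac a b *_) (frac1-*ι {b} (ℕ.s≤s ℕ.z≤n)) ⟨
  frac a b * (frac 1 b * ι b)     ≡⟨ shuffle (frac a b) (frac 1 b) (ι b) ⟩
  frac a b * ι b * frac 1 b       ≡⟨ cong (_* frac 1 b) (frac-*ι a (ℕ.s≤s ℕ.z≤n)) ⟩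
  ι a * frac 1 b                  ∎
  where
  open ≡-Reasoning
  shuffle : ∀ p q r → p * (q * r) ≡ p * r * q
  shuffle = solve-∀ ℚ-ring

0≤frac1 : ∀ b → 0ℚ ≤ frac 1 b
0≤frac1 zero    = ≤-refl
0≤frac1 (suc b) = nonNegative⁻¹ (ℤ.+ 1 / suc b) {{normalize-nonNeg 1 (suc b)}}

0<frac1 : ∀ {b} → 0 ℕ.< b → 0ℚ < frac 1 b
0<frac1 {suc b} _ = positive⁻¹ (ℤ.+ 1 / suc b) {{normalize-pos 1 (suc b)}}

0<frac : ∀ {a b} → 0 ℕ.< a → 0 ℕ.< b → 0ℚ < frac a b
0<frac {a} {b} 0<a 0<b = subst (0ℚ <_) (sym (frac≡ι*frac1 a b)) (0<* (0<ι 0<a) (0<frac1 0<b))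

frac1-anti : ∀ {a b} → 0 ℕ.< a → a ℕ.≤ b → frac 1 b ≤ frac 1 a
frac1-anti {a} {b} 0<a a≤b = begin
  frac 1 b                        ≡⟨ *-identityʳ (frac 1 b) ⟨
  frac 1 b * 1ℚ                   ≡⟨ cong (frac 1 b *_) (frac1-*ι 0<a) ⟨
  frac 1 b * (frac 1 a * ι a)     ≤⟨ *-monoˡ-≤ (frac 1 b) (0≤frac1 b) (*-monoˡ-≤ (frac 1 a) (0≤frac1 a) (ι-mono a≤b)) ⟩
  frac 1 b * (frac 1 a * ι b)     ≡⟨ shuffle (frac 1 b) (frac 1 a) (ι b) ⟩
  frac 1 a * (frac 1 b * ι b)     ≡⟨ cong (frac 1 a *_) (frac1-*ι (ℕₚ.≤-trans 0<a a≤b)) ⟩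
  frac 1 a * 1ℚ                   ≡⟨ *-identityʳ (frac 1 a) ⟩
  frac 1 a                        ∎
  where
  open ≤-Reasoning
  shuffle : ∀ p q r → p * (q * r) ≡ q * (p * r)
  shuffle = solve-∀ ℚ-ring

ι-sum : ∀ {A : Set} (f : A → ℕ) L → ι (sum (map f L)) ≡ ∑ L (ι ∘ f)
ι-sum f []      = refl
ι-sum f (x ∷ L) = trans (ι-+ (f x) _) (cong (ι (f x) +_) (ι-sum f L))

ι-length-filterᵇ : ∀ {A : Set} (p : A → Bool) L → ι (length (filterᵇ p L)) ≡ ∑ L (χ ∘ p)
ι-length-filterᵇ p []      = refl
ι-length-filterᵇ p (x ∷ L) with p x
... | true  = cong (1ℚ +_) (ι-length-filterᵇ p L)
... | false = trans (ι-length-filterᵇ p L) (sym (+-identityˡ _))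

maxL-upper : ∀ {A : Set} (f : A → ℕ) {L x} → x ∈ L → f x ℕ.≤ maxL (map f L)
maxL-upper f {y ∷ L} (here refl) = ℕₚ.m≤m⊔n (f y) _
maxL-upper f {y ∷ L} (there x∈)  = ℕₚ.≤-trans (maxL-upper f x∈) (ℕₚ.m≤n⊔m (f y) _)

module _ {A : Set} (f : A → ℕ) where
  private
    minFrom : ℕ → List A → ℕ
    minFrom b L = foldr ℕ._⊓_ b (map f L)

    minFrom≤base : ∀ b L → minFrom b L ℕ.≤ b
    minFrom≤base b []      = ℕₚ.≤-refl
    minFrom≤base b (y ∷ L) = ℕₚ.≤-trans (ℕₚ.m⊓n≤n (f y) _) (minFrom≤base b L)

    minFrom-lower : ∀ b {L x} → x ∈ L → minFrom b L ℕ.≤ f x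
    minFrom-lower b {y ∷ L} (here refl) = ℕₚ.m⊓n≤m (f y) _
    minFrom-lower b {y ∷ L} (there x∈)  = ℕₚ.≤-trans (ℕₚ.m⊓n≤n (f y) _) (minFrom-lower b x∈)

    0<minFrom : ∀ {b} L → 0 ℕ.< b → (∀ {x} → x ∈ L → 0 ℕ.< f x) → 0 ℕ.< minFrom b L
    0<minFrom []      0<b 0<f = 0<b
    0<minFrom (y ∷ L) 0<b 0<f = ℕₚ.⊓-glb (0<f (here refl)) (0<minFrom L 0<b (0<f ∘ there))

  minL-lower : ∀ {L x} → x ∈ L → minL (map f L) ℕ.≤ f x
  minL-lower {y ∷ L} (here refl) = minFrom≤base (f y) L
  minL-lower {y ∷ L} (there x∈)  = minFrom-lower (f y) x∈

  0<minL : ∀ {L x} → x ∈ L → (∀ {y} → y ∈ L → 0 ℕ.< f y) → 0 ℕ.< minL (map f L)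
  0<minL {y ∷ L} _ 0<f = 0<minFrom L (0<f (here refl)) (0<f ∘ there)

-- Boolean predicates on lists and subsets

∧-true : ∀ {a b} → a ∧ b ≡ true → a ≡ true × b ≡ true
∧-true {true} {true} _ = refl , refl

true⇒¬false : ∀ {b} → b ≡ true → ¬ b ≡ false
true⇒¬false refl ()

≡ᵇ-sound : ∀ m n → (m ≡ᵇ n) ≡ true → m ≡ n
≡ᵇ-sound m n eq = ℕₚ.≡ᵇ⇒≡ m n (subst T (sym eq) _)

≡ᵇ-refl : ∀ m → (m ≡ᵇ m) ≡ true
≡ᵇ-refl zero    = refl
≡ᵇ-refl (suc m) = ≡ᵇ-refl m

≢⇒≡ᵇ-false : ∀ {m n} → ¬ m ≡ n → (m ≡ᵇ n) ≡ false
≢⇒≡ᵇ-false {m} {n} m≢n = Boolₚ.¬-not (m≢n ∘ ≡ᵇ-sound m n)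

module _ {A : Set} (p : A → Bool) where

  any-sound : ∀ L → any p L ≡ true → ∃ λ x → x ∈ L × p x ≡ true
  any-sound (y ∷ L) eq with p y in py
  ... | true  = y , here refl , py
  ... | false with any-sound L eq
  ...   | x , x∈ , px = x , there x∈ , px

  any-complete : ∀ {L x} → x ∈ L → p x ≡ true → any p L ≡ true
  any-complete {y ∷ L} (here refl) px rewrite px = refl
  any-complete {y ∷ L} (there x∈)  px rewrite any-complete x∈ px = Boolₚ.∨-zeroʳ (p y)

  ∈-filterᵇ⁻ : ∀ {L x} → x ∈ filterᵇ p L → p x ≡ true
  ∈-filterᵇ⁻ {y ∷ L} x∈ with p y in py
  ∈-filterᵇ⁻ {y ∷ L} (here refl) | true  = py
  ∈-filterᵇ⁻ {y ∷ L} (there x∈)  | true  = ∈-filterᵇ⁻ {L} x∈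
  ∈-filterᵇ⁻ {y ∷ L} x∈          | false = ∈-filterᵇ⁻ {L} x∈

  ∈-filterᵇ⁺ : ∀ {L x} → x ∈ L → p x ≡ true → x ∈ filterᵇ p L
  ∈-filterᵇ⁺ {y ∷ L} (here refl) px rewrite px = here refl
  ∈-filterᵇ⁺ {y ∷ L} (there x∈)  px with p y
  ... | true  = there (∈-filterᵇ⁺ x∈ px)
  ... | false = ∈-filterᵇ⁺ x∈ px

isSub-trans : ∀ {n} (s t u : Subset n) → isSub s t ≡ true → isSub t u ≡ true → isSub s u ≡ true
isSub-trans [] [] [] _ _ = refl
isSub-trans (false ∷ s) (b ∷ t) (c ∷ u) p q = isSub-trans s t u p (proj₂ (∧-true {not b ∨ c} q))
isSub-trans (true ∷ s) (true ∷ t) (true ∷ u) p q = isSub-trans s t u p q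

isSub-∪ : ∀ {n} (s t u : Subset n) → isSub (s ∪ t) u ≡ isSub s u ∧ isSub t u
isSub-∪ [] [] [] = refl
isSub-∪ (false ∷ s) (false ∷ t) (c ∷ u) = isSub-∪ s t u
isSub-∪ (false ∷ s) (true ∷ t) (false ∷ u) = sym (Boolₚ.∧-zeroʳ (isSub s u))
isSub-∪ (false ∷ s) (true ∷ t) (true ∷ u) = isSub-∪ s t u
isSub-∪ (true ∷ s) (false ∷ t) (false ∷ u) = refl
isSub-∪ (true ∷ s) (false ∷ t) (true ∷ u) = isSub-∪ s t u
isSub-∪ (true ∷ s) (true ∷ t) (false ∷ u) = refl
isSub-∪ (true ∷ s) (true ∷ t) (true ∷ u) = isSub-∪ s t u

isSub-∪ˡ : ∀ {n} (s t : Subset n) → isSub s (s ∪ t) ≡ true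
isSub-∪ˡ [] [] = refl
isSub-∪ˡ (false ∷ s) (b ∷ t) = isSub-∪ˡ s t
isSub-∪ˡ (true ∷ s) (b ∷ t) = isSub-∪ˡ s t

isSub-size : ∀ {n} (s t : Subset n) → isSub s t ≡ true → size s ℕ.≤ size t
isSub-size [] [] _ = ℕ.z≤n
isSub-size (false ∷ s) (false ∷ t) p = isSub-size s t p
isSub-size (false ∷ s) (true ∷ t) p = ℕₚ.m≤n⇒m≤1+n (isSub-size s t p)
isSub-size (true ∷ s) (true ∷ t) p = ℕ.s≤s (isSub-size s t p)

isSub-size-≡ : ∀ {n} (s t : Subset n) → isSub s t ≡ true → size t ℕ.≤ size s → s ≡ t
isSub-size-≡ [] [] _ _ = refl
isSub-size-≡ (false ∷ s) (false ∷ t) p q = cong (false ∷_) (isSub-size-≡ s t p q)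
isSub-size-≡ (false ∷ s) (true ∷ t) p q = contradiction (ℕₚ.≤-trans q (isSub-size s t p)) ℕₚ.1+n≰n
isSub-size-≡ (true ∷ s) (true ∷ t) p (ℕ.s≤s q) = cong (true ∷_) (isSub-size-≡ s t p q)

isSub-refl : ∀ {n} (s : Subset n) → isSub s s ≡ true
isSub-refl [] = refl
isSub-refl (false ∷ s) = isSub-refl s
isSub-refl (true ∷ s) = isSub-refl s

eqS-refl : ∀ {n} (s : Subset n) → eqS s s ≡ true
eqS-refl [] = refl
eqS-refl (false ∷ s) = eqS-refl s
eqS-refl (true ∷ s) = eqS-refl s

eqS-sound : ∀ {n} (s t : Subset n) → eqS s t ≡ true → s ≡ t
eqS-sound [] [] _ = refl
eqS-sound (false ∷ s) (false ∷ t) p = cong (false ∷_) (eqS-sound s t p)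
eqS-sound (true ∷ s) (true ∷ t) p = cong (true ∷_) (eqS-sound s t p)

bool-ext : ∀ {a b} → (a ≡ true → b ≡ true) → (b ≡ true → a ≡ true) → a ≡ b
bool-ext {true}  {b}     f g = sym (f refl)
bool-ext {false} {false} f g = refl
bool-ext {false} {true}  f g = g refl

eqS-sym : ∀ {n} (s t : Subset n) → eqS s t ≡ eqS t s
eqS-sym s t = bool-ext (half s t) (half t s)
  where
  half : ∀ s t → eqS s t ≡ true → eqS t s ≡ true
  half s t eq rewrite eqS-sound s t eq = eqS-refl t

-- A superset of `s` with only `k ≤ size s` elements is `s` itself, and for `k < size s` both sides
-- are false. Thus a sum over supersets of size `k` collapses to at most one term.
isSub-eqS : ∀ {n} k (s t : Subset n) → k ℕ.≤ size s → isSub s t ∧ (size t ≡ᵇ k) ≡ eqS s t ∧ (size s ≡ᵇ k)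
isSub-eqS k s t k≤s = bool-ext forth back
  where
  forth : isSub s t ∧ (size t ≡ᵇ k) ≡ true → eqS s t ∧ (size s ≡ᵇ k) ≡ true
  forth e with ∧-true {isSub s t} e
  ... | p , q with isSub-size-≡ s t p (ℕₚ.≤-trans (ℕₚ.≤-reflexive (≡ᵇ-sound (size t) k q)) k≤s)
  ...   | refl = cong₂ _∧_ (eqS-refl s) q
  back : eqS s t ∧ (size s ≡ᵇ k) ≡ true → isSub s t ∧ (size t ≡ᵇ k) ≡ true
  back e with ∧-true {eqS s t} e
  ... | p , q with eqS-sound s t p
  ...   | refl = cong₂ _∧_ (isSub-refl s) q

∈-allSubsets : ∀ {n} (s : Subset n) → s ∈ allSubsets n
∈-allSubsets [] = here refl
∈-allSubsets {suc n} (false ∷ s) = ∈-++⁺ˡ (∈-map⁺ (false ∷_) (∈-allSubsets s))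
∈-allSubsets {suc n} (true ∷ s)  = ∈-++⁺ʳ (map (false ∷_) (allSubsets n)) (∈-map⁺ (true ∷_) (∈-allSubsets s))

subset-of-size : ∀ {n} (f : Subset n) k → k ℕ.≤ size f → ∃ λ s → isSub s f ≡ true × size s ≡ k
subset-of-size [] zero _ = [] , refl , refl
subset-of-size (false ∷ f) k k≤ with subset-of-size f k k≤
... | s , p , q = false ∷ s , p , q
subset-of-size (true ∷ f) zero k≤ with subset-of-size f zero ℕ.z≤n
... | s , p , q = false ∷ s , p , q
subset-of-size (true ∷ f) (suc k) (ℕ.s≤s k≤) with subset-of-size f k k≤
... | s , p , q = true ∷ s , p , cong suc q

-- `W` tests membership of the first element of `f`, so it separates two of the singletons in `f`.
-- It serves as a test cochain that is neither empty nor everything.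
split-vertices : ∀ {n} (f : Subset n) → 2 ℕ.≤ size f → ∃ λ (W : Subset n → Bool) → ∃ λ σ → ∃ λ σ′ →
  (isSub σ f ≡ true × size σ ≡ 1 × W σ ≡ true) × (isSub σ′ f ≡ true × size σ′ ≡ 1 × W σ′ ≡ false)
split-vertices (false ∷ f) 2≤ with split-vertices f 2≤
... | W , σ , σ′ , p , q = W ∘ tail , false ∷ σ , false ∷ σ′ , p , q
split-vertices (true ∷ f) (ℕ.s≤s 1≤) with subset-of-size f 0 ℕ.z≤n | subset-of-size f 1 1≤
... | s , s⊆f , |s| | s′ , s′⊆f , |s′| =
  head , true ∷ s , false ∷ s′ , (s⊆f , cong suc |s| , refl) , (s′⊆f , |s′| , refl)

-- Counting subsets

∑-allSubsets : ∀ n (g : Subset (suc n) → ℚ) →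
  ∑ (allSubsets (suc n)) g ≡ ∑ (allSubsets n) (g ∘ (false ∷_)) + ∑ (allSubsets n) (g ∘ (true ∷_))
∑-allSubsets n g = trans (∑-++ (map (false ∷_) (allSubsets n)) _ g)
  (cong₂ _+_ (∑-map (false ∷_) (allSubsets n) g) (∑-map (true ∷_) (allSubsets n) g))

∑-0*ˡ : ∀ {A : Set} (L : List A) (g : A → ℚ) → ∑ L (λ x → 0ℚ * g x) ≡ 0ℚ
∑-0*ˡ L g = ∑-zero L (λ {x} _ → *-zeroˡ (g x))

∑-eqS : ∀ {n} (s : Subset n) (g : Subset n → ℚ) → ∑ (allSubsets n) (λ t → χ (eqS s t) * g t) ≡ g s
∑-eqS [] g = trans (+-identityʳ _) (*-identityˡ (g []))
∑-eqS {suc n} (false ∷ s) g = trans (∑-allSubsets n _)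
  (trans (cong₂ _+_ (∑-eqS s (g ∘ (false ∷_))) (∑-0*ˡ (allSubsets n) (g ∘ (true ∷_)))) (+-identityʳ _))
∑-eqS {suc n} (true ∷ s) g = trans (∑-allSubsets n _)
  (trans (cong₂ _+_ (∑-0*ˡ (allSubsets n) (g ∘ (false ∷_))) (∑-eqS s (g ∘ (true ∷_)))) (+-identityˡ _))

∑-isSub-size : ∀ {n} k (s : Subset n) → k ℕ.≤ size s → ∀ (g : Subset n → ℚ) →
  ∑ (allSubsets n) (λ t → χ (isSub s t) * (χ (size t ≡ᵇ k) * g t)) ≡ χ (size s ≡ᵇ k) * g s
∑-isSub-size {n} k s k≤s g = trans (∑-cong (allSubsets n) λ {t} _ → pointwise t) (∑-eqS s (λ t → χ (size s ≡ᵇ k) * g t))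
  where
  pointwise : ∀ t → χ (isSub s t) * (χ (size t ≡ᵇ k) * g t) ≡ χ (eqS s t) * (χ (size s ≡ᵇ k) * g t)
  pointwise t = trans (sym (*-assoc (χ (isSub s t)) (χ (size t ≡ᵇ k)) (g t))) (trans (cong (_* g t)
    (trans (sym (χ-∧ (isSub s t) _)) (trans (cong χ (isSub-eqS k s t k≤s)) (χ-∧ (eqS s t) _))))
    (*-assoc (χ (eqS s t)) (χ (size s ≡ᵇ k)) (g t)))

-- A set `t` between `s` and `f` with one element more than `s` is determined by an element of `f`
-- outside `s`. If `s` is not inside `f`, both sides vanish, so a negative difference on the right
-- does no harm.
∑-between : ∀ {n} (s f : Subset n) →
  ∑ (allSubsets n) (λ t → χ (isSub s t) * (χ (size t ≡ᵇ suc (size s)) * χ (isSub t f))) ≡ χ (isSub s f) * (ι (size f) - ι (size s))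
∑-between [] [] = refl
∑-between {suc n} (false ∷ s) (false ∷ f) = trans (∑-allSubsets n _)
  (trans (cong₂ _+_ (∑-between s f) (∑-zero (allSubsets n) λ {t} _ → zeros (χ (isSub s t)) (χ (suc (size t) ≡ᵇ suc (size s))))) (+-identityʳ _))
  where
  zeros : ∀ a b → a * (b * 0ℚ) ≡ 0ℚ
  zeros = solve-∀ ℚ-ring
-- The new element lies in `f` but not in `s`: either `t` omits it, which is the induction
-- hypothesis, or it is the one added element and the rest of `t` equals `s`.
∑-between {suc n} (false ∷ s) (true ∷ f) = trans (∑-allSubsets n _)
  (trans (cong₂ _+_ (∑-between s f) (trans (∑-isSub-size (size s) s ℕₚ.≤-refl (λ t → χ (isSub t f))) (cong (λ b → χ b * χ (isSub s f)) (≡ᵇ-refl (size s)))))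
  (collect (χ (isSub s f)) (ι (size f)) (ι (size s))))
  where
  collect : ∀ c a b → c * (a - b) + 1ℚ * c ≡ c * (1ℚ + a - b)
  collect = solve-∀ ℚ-ring
∑-between {suc n} (true ∷ s) (false ∷ f) = trans (∑-allSubsets n _)
  (trans (cong₂ _+_ (∑-0*ˡ (allSubsets n) (λ t → χ (size t ≡ᵇ suc (suc (size s))) * χ (isSub (false ∷ t) (false ∷ f)))) (∑-zero (allSubsets n) λ {t} _ → zeros (χ (isSub s t)) (χ (suc (size t) ≡ᵇ suc (suc (size s)))))) (sym (*-zeroˡ (ι (size f) - (1ℚ + ι (size s))))))
  where
  zeros : ∀ a b → a * (b * 0ℚ) ≡ 0ℚ
  zeros = solve-∀ ℚ-ring
∑-between {suc n} (true ∷ s) (true ∷ f) = trans (∑-allSubsets n _)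
  (trans (cong₂ _+_ (∑-0*ˡ (allSubsets n) (λ t → χ (size t ≡ᵇ suc (suc (size s))) * χ (isSub (false ∷ t) (true ∷ f)))) (∑-between s f)) (collect (χ (isSub s f)) (ι (size f)) (ι (size s))))
  where
  collect : ∀ c a b → 0ℚ + c * (a - b) ≡ c * (1ℚ + a - (1ℚ + b))
  collect = solve-∀ ℚ-ring

-- Each element of `t` can be removed. The size condition puts the successor on the side of `s`,
-- which covers the empty `t` without truncated subtraction.
∑-codim1 : ∀ {n} (t : Subset n) → ∑ (allSubsets n) (λ s → χ (suc (size s) ≡ᵇ size t) * χ (isSub s t)) ≡ ι (size t)
∑-codim1 [] = refl
∑-codim1 {suc n} (false ∷ t) = trans (∑-allSubsets n _)
  (trans (cong₂ _+_ (∑-codim1 t) (∑-zero (allSubsets n) λ {s} _ → *-zeroʳ (χ (suc (suc (size s)) ≡ᵇ size t)))) (+-identityʳ _))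
∑-codim1 {suc n} (true ∷ t) = trans (∑-allSubsets n _)
  (cong₂ _+_ whole (∑-codim1 t))
  where
  same : ∀ s → (size s ≡ᵇ size t) ∧ isSub s t ≡ eqS t s
  same s = bool-ext
    (λ e → let p , q = ∧-true {size s ≡ᵇ size t} e in
      subst (λ u → eqS t u ≡ true) (sym (isSub-size-≡ s t q (ℕₚ.≤-reflexive (sym (≡ᵇ-sound (size s) (size t) p))))) (eqS-refl t))
    (λ e → subst (λ u → (size u ≡ᵇ size t) ∧ isSub u t ≡ true) (eqS-sound t s e) (cong₂ _∧_ (≡ᵇ-refl (size t)) (isSub-refl t)))
  whole : ∑ (allSubsets n) (λ s → χ (size s ≡ᵇ size t) * χ (isSub s t)) ≡ 1ℚ
  whole = trans (∑-cong (allSubsets n) λ {s} _ → trans (sym (χ-∧ (size s ≡ᵇ size t) _)) (trans (cong χ (same s)) (sym (*-identityʳ _))))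
    (∑-eqS t (λ _ → 1ℚ))

-- Face degrees and expansion

module Faces {n d : ℕ} (X : PureComplex n d) where
  open PureComplex X

  Δ : Subset n → ℚ
  Δ s = ι (deg X s)

  Δ≡∑ : ∀ s → Δ s ≡ ∑ facets (λ f → χ (isSub s f))
  Δ≡∑ s = ι-length-filterᵇ (isSub s) facets

  0≤Δ : ∀ s → 0ℚ ≤ Δ s
  0≤Δ s = 0≤ι (deg X s)

  ∈faces⇒size : ∀ {k s} → s ∈ faces X k → size s ≡ suc k
  ∈faces⇒size {k} {s} s∈ = ≡ᵇ-sound (size s) (suc k) (proj₁ (∧-true {size s ≡ᵇ suc k} (∈-filterᵇ⁻ (isFace X k) {allSubsets n} s∈)))

  ∈faces⇒facet : ∀ {k s} → s ∈ faces X k → ∃ λ f → f ∈ facets × isSub s f ≡ true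
  ∈faces⇒facet {k} {s} s∈ = any-sound (isSub s) facets (proj₂ (∧-true {size s ≡ᵇ suc k} (∈-filterᵇ⁻ (isFace X k) {allSubsets n} s∈)))

  ⊆facet⇒∈faces : ∀ {k s f} → f ∈ facets → isSub s f ≡ true → size s ≡ suc k → s ∈ faces X k
  ⊆facet⇒∈faces {k} {s} f∈ s⊆f |s| = ∈-filterᵇ⁺ (isFace X k) (∈-allSubsets s)
    (cong₂ _∧_ (trans (cong (_≡ᵇ suc k) |s|) (≡ᵇ-refl (suc k))) (any-complete (isSub s) f∈ s⊆f))

  0<deg : ∀ {k s} → s ∈ faces X k → 0 ℕ.< deg X s
  0<deg {k} {s} s∈ with ∈faces⇒facet {k} s∈
  ... | f , f∈ , s⊆f = nonempty-length (∈-filterᵇ⁺ (isSub s) f∈ s⊆f)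
    where
    nonempty-length : ∀ {L : List (Subset n)} {x} → x ∈ L → 0 ℕ.< length L
    nonempty-length (here _)  = ℕ.s≤s ℕ.z≤n
    nonempty-length (there _) = ℕ.s≤s ℕ.z≤n

  ∃-facet : ∃ λ f → f ∈ facets × size f ≡ suc d
  ∃-facet = go facets nonempty facetSize
    where
    go : ∀ L → L ≢ [] → All (λ f → size f ≡ suc d) L → ∃ λ f → f ∈ L × size f ≡ suc d
    go []      L≢[] _ = contradiction refl L≢[]
    go (f ∷ L) _ (e All.∷ _) = f , here refl , e

  ∃-face : ∀ {k} → k ℕ.≤ d → ∃ λ s → s ∈ faces X k
  ∃-face {k} k≤d with ∃-facet
  ... | f , f∈ , |f| with subset-of-size f (suc k) (ℕₚ.≤-trans (ℕ.s≤s k≤d) (ℕₚ.≤-reflexive (sym |f|)))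
  ...   | s , s⊆f , |s| = s , ⊆facet⇒∈faces f∈ s⊆f |s|

  -- A set contained in no facet has degree zero, so the weight `Δ` already removes it.
  -- Degree-weighted sums over faces thereby become sums over all subsets of a given size, where the
  -- counting recursions apply.
  isFace*Δ : ∀ k s → χ (isFace X k s) * Δ s ≡ χ (size s ≡ᵇ suc k) * Δ s
  isFace*Δ k s with any (isSub s) facets in eq
  ... | true  = cong (λ b → χ b * Δ s) (Boolₚ.∧-identityʳ (size s ≡ᵇ suc k))
  ... | false = trans (cong (χ ((size s ≡ᵇ suc k) ∧ false) *_) Δ≡0)
                  (trans (*-zeroʳ (χ ((size s ≡ᵇ suc k) ∧ false))) (sym (trans (cong (χ (size s ≡ᵇ suc k) *_) Δ≡0) (*-zeroʳ (χ (size s ≡ᵇ suc k))))))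
    where
    Δ≡0 : Δ s ≡ 0ℚ
    Δ≡0 = trans (Δ≡∑ s) (∑-zero facets λ {f} f∈ →
      cong χ (Boolₚ.¬-not λ s⊆f → true⇒¬false (any-complete (isSub s) f∈ s⊆f) eq))

  ∑-faces-Δ : ∀ k (g : Subset n → ℚ) → ∑ (faces X k) (λ s → Δ s * g s) ≡ ∑ (allSubsets n) (λ s → χ (size s ≡ᵇ suc k) * (Δ s * g s))
  ∑-faces-Δ k g = trans (∑-filterᵇ (isFace X k) (allSubsets n) _) (∑-cong (allSubsets n) λ {s} _ →
    trans (sym (*-assoc (χ (isFace X k s)) (Δ s) (g s))) (trans (cong (_* g s) (isFace*Δ k s)) (*-assoc (χ (size s ≡ᵇ suc k)) (Δ s) (g s))))

  ∑-faces-eqS : ∀ {k s} → s ∈ faces X k → ∀ (g : Subset n → ℚ) → ∑ (faces X k) (λ t → χ (eqS s t) * g t) ≡ g s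
  ∑-faces-eqS {k} {s} s∈ g = trans (∑-filterᵇ (isFace X k) (allSubsets n) _) (trans
    (∑-cong (allSubsets n) λ {t} _ → left-comm (χ (isFace X k t)) (χ (eqS s t)) (g t))
    (trans (∑-eqS s (λ t → χ (isFace X k t) * g t))
      (trans (cong (λ b → χ b * g s) (∈-filterᵇ⁻ (isFace X k) {allSubsets n} s∈)) (*-identityˡ (g s)))))
    where
    left-comm : ∀ a b c → a * (b * c) ≡ b * (a * c)
    left-comm = solve-∀ ℚ-ring

  -- Double counting between faces of dimensions `i` and `i + 1`.

  module Dimension (i : ℕ) where

    V E : List (Subset n)
    V = faces X i
    E = faces X (suc i)

    -- The number of `(i+1)`-faces between an `i`-face and a facet containing it.
    codeg : ℚ
    codeg = ι d - ι i

    -- Double counting of the pairs of a coface `τ` of `σ` and a facet containing `τ`. By purity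
    -- every facet over `σ` contributes the same number `codeg`.
    ∑-cofaces : ∀ {σ} → σ ∈ V → ∑ E (λ τ → Δ τ * χ (isSub σ τ)) ≡ codeg * Δ σ
    ∑-cofaces {σ} σ∈ = begin
      ∑ E (λ τ → Δ τ * χ (isSub σ τ))
        ≡⟨ ∑-faces-Δ (suc i) (λ τ → χ (isSub σ τ)) ⟩
      ∑ (allSubsets n) (λ τ → χ (size τ ≡ᵇ suc (suc i)) * (Δ τ * χ (isSub σ τ)))
        ≡⟨ ∑-cong (allSubsets n) (λ {τ} _ → spread τ) ⟩
      ∑ (allSubsets n) (λ τ → ∑ facets (λ f → χ (isSub σ τ) * (χ (size τ ≡ᵇ suc (size σ)) * χ (isSub τ f))))
        ≡⟨ ∑-swap (allSubsets n) facets _ ⟩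
      ∑ facets (λ f → ∑ (allSubsets n) (λ τ → χ (isSub σ τ) * (χ (size τ ≡ᵇ suc (size σ)) * χ (isSub τ f))))
        ≡⟨ ∑-cong facets (λ {f} f∈ → trans (∑-between σ f) (trans (cong₂ (λ a b → χ (isSub σ f) * (ι a - ι b)) (All.lookup facetSize f∈) (∈faces⇒size {i} σ∈)) (simplify (χ (isSub σ f)) (ι d) (ι i)))) ⟩
      ∑ facets (λ f → codeg * χ (isSub σ f))
        ≡⟨ ∑-*ˡ facets codeg _ ⟩
      codeg * ∑ facets (λ f → χ (isSub σ f))
        ≡⟨ cong (codeg *_) (Δ≡∑ σ) ⟨
      codeg * Δ σ ∎
      where
      open ≡-Reasoning
      simplify : ∀ c a b → c * (1ℚ + a - (1ℚ + b)) ≡ (a - b) * c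
      simplify = solve-∀ ℚ-ring
      rotate : ∀ a b c → a * (b * c) ≡ c * a * b
      rotate = solve-∀ ℚ-ring
      spread : ∀ τ → χ (size τ ≡ᵇ suc (suc i)) * (Δ τ * χ (isSub σ τ))
        ≡ ∑ facets (λ f → χ (isSub σ τ) * (χ (size τ ≡ᵇ suc (size σ)) * χ (isSub τ f)))
      spread τ rewrite ∈faces⇒size {i} σ∈ = trans (rotate (χ (size τ ≡ᵇ suc (suc i))) (Δ τ) (χ (isSub σ τ)))
        (trans (cong (χ (isSub σ τ) * χ (size τ ≡ᵇ suc (suc i)) *_) (Δ≡∑ τ))
        (trans (sym (∑-*ˡ facets (χ (isSub σ τ) * χ (size τ ≡ᵇ suc (suc i))) (λ f → χ (isSub τ f))))
          (∑-cong facets λ {f} _ → *-assoc (χ (isSub σ τ)) (χ (size τ ≡ᵇ suc (suc i))) (χ (isSub τ f)))))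

    ∑-subfaces : ∀ {τ} → τ ∈ E → ∑ V (λ σ → χ (isSub σ τ)) ≡ ι (suc (suc i))
    ∑-subfaces {τ} τ∈ = trans (∑-filterᵇ (isFace X i) (allSubsets n) _)
      (trans (∑-cong (allSubsets n) λ {σ} _ → trans (sym (χ-∧ (isFace X i σ) (isSub σ τ))) (trans (cong χ (same σ)) (χ-∧ (suc (size σ) ≡ᵇ size τ) (isSub σ τ))))
        (trans (∑-codim1 τ) (cong ι (∈faces⇒size {suc i} τ∈))))
      where
      same : ∀ σ → isFace X i σ ∧ isSub σ τ ≡ (suc (size σ) ≡ᵇ size τ) ∧ isSub σ τ
      same σ rewrite ∈faces⇒size {suc i} τ∈ = bool-ext
        (λ e → let p , q = ∧-true {isFace X i σ} e in cong₂ _∧_ (proj₁ (∧-true {size σ ≡ᵇ suc i} p)) q)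
        (λ e → let p , q = ∧-true {size σ ≡ᵇ suc i} e
                   f , f∈ , τ⊆f = ∈faces⇒facet {suc i} τ∈
               in cong₂ _∧_ (cong₂ _∧_ p (any-complete (isSub σ) f∈ (isSub-trans σ τ f q τ⊆f))) q)

    -- Incident pairs are counted from both ends. The identity compares the normalising sums of the
    -- norms in the two consecutive dimensions.
    degSum-ratio : ι (suc (suc i)) * ι (degSum X E) ≡ codeg * ι (degSum X V)
    degSum-ratio = begin
      ι (suc (suc i)) * ι (degSum X E)
        ≡⟨ cong (ι (suc (suc i)) *_) (ι-sum (deg X) E) ⟩
      ι (suc (suc i)) * ∑ E Δ
        ≡⟨ trans (*-comm (ι (suc (suc i))) (∑ E Δ)) (sym (∑-*ʳ E (ι (suc (suc i))) Δ)) ⟩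
      ∑ E (λ τ → Δ τ * ι (suc (suc i)))
        ≡⟨ ∑-cong E (λ {τ} τ∈ → trans (cong (Δ τ *_) (sym (∑-subfaces τ∈))) (sym (∑-*ˡ V (Δ τ) (λ σ → χ (isSub σ τ))))) ⟩
      ∑ E (λ τ → ∑ V (λ σ → Δ τ * χ (isSub σ τ)))
        ≡⟨ ∑-swap E V _ ⟩
      ∑ V (λ σ → ∑ E (λ τ → Δ τ * χ (isSub σ τ)))
        ≡⟨ ∑-cong V ∑-cofaces ⟩
      ∑ V (λ σ → codeg * Δ σ)
        ≡⟨ ∑-*ˡ V codeg Δ ⟩
      codeg * ∑ V Δ
        ≡⟨ cong (codeg *_) (ι-sum (deg X) V) ⟨
      codeg * ι (degSum X V) ∎
      where open ≡-Reasoning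

    N : Subset n → Subset n → ℚ
    N σ σ′ = ι (nbrW X i σ σ′)

    N≡ : ∀ σ σ′ → N σ σ′ ≡ χ (isFace X (suc i) (σ ∪ σ′)) * Δ (σ ∪ σ′)
    N≡ σ σ′ with isFace X (suc i) (σ ∪ σ′)
    ... | true  = sym (*-identityˡ (Δ (σ ∪ σ′)))
    ... | false = sym (*-zeroˡ (Δ (σ ∪ σ′)))

    N-sym : ∀ σ σ′ → N σ σ′ ≡ N σ′ σ
    N-sym σ σ′ = trans (N≡ σ σ′) (trans (cong (λ s → χ (isFace X (suc i) s) * Δ s) (∪-comm σ σ′)) (sym (N≡ σ′ σ)))

    0≤N : ∀ σ σ′ → 0ℚ ≤ N σ σ′
    0≤N σ σ′ = 0≤ι (nbrW X i σ σ′)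

    N-diag : ∀ {σ} → σ ∈ V → N σ σ ≡ 0ℚ
    N-diag {σ} σ∈ = trans (N≡ σ σ) (trans (cong (λ b → χ b * Δ (σ ∪ σ)) notFace) (*-zeroˡ (Δ (σ ∪ σ))))
      where
      notFace : isFace X (suc i) (σ ∪ σ) ≡ false
      notFace rewrite ∪-idem σ | ∈faces⇒size {i} σ∈ | ≢⇒≡ᵇ-false {i} {suc i} (λ ()) = refl

    -- Two distinct `i`-faces have a union of at least `i + 2` elements, so only the union itself
    -- can be a common coface. For equal faces `N` vanishes and all cofaces of `σ` count, which is
    -- the diagonal term.
    common-cofaces : ∀ {σ σ′} → σ ∈ V → σ′ ∈ V →
      ∑ E (λ τ → Δ τ * (χ (isSub σ τ) * χ (isSub σ′ τ))) ≡ N σ σ′ + χ (eqS σ σ′) * (codeg * Δ σ)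
    common-cofaces {σ} {σ′} σ∈ σ′∈ with eqS σ σ′ in eq
    ... | true with eqS-sound σ σ′ eq
    ...   | refl = trans (∑-cong E λ {τ} _ → cong (Δ τ *_) (idem (isSub σ τ))) (trans (∑-cofaces σ∈)
              (trans (pad (codeg * Δ σ)) (cong (_+ 1ℚ * (codeg * Δ σ)) (sym (N-diag σ∈)))))
      where
      idem : ∀ b → χ b * χ b ≡ χ b
      idem true  = refl
      idem false = refl
      pad : ∀ a → a ≡ 0ℚ + 1ℚ * a
      pad = solve-∀ ℚ-ring
    common-cofaces {σ} {σ′} σ∈ σ′∈ | false = begin
      ∑ E (λ τ → Δ τ * (χ (isSub σ τ) * χ (isSub σ′ τ)))
        ≡⟨ ∑-cong E (λ {τ} _ → cong (Δ τ *_) (trans (sym (χ-∧ (isSub σ τ) (isSub σ′ τ))) (cong χ (sym (isSub-∪ σ σ′ τ))))) ⟩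
      ∑ E (λ τ → Δ τ * χ (isSub (σ ∪ σ′) τ))
        ≡⟨ ∑-faces-Δ (suc i) (λ τ → χ (isSub (σ ∪ σ′) τ)) ⟩
      ∑ (allSubsets n) (λ τ → χ (size τ ≡ᵇ suc (suc i)) * (Δ τ * χ (isSub (σ ∪ σ′) τ)))
        ≡⟨ ∑-cong (allSubsets n) (λ {τ} _ → rotate (χ (size τ ≡ᵇ suc (suc i))) (Δ τ) (χ (isSub (σ ∪ σ′) τ))) ⟩
      ∑ (allSubsets n) (λ τ → χ (isSub (σ ∪ σ′) τ) * (χ (size τ ≡ᵇ suc (suc i)) * Δ τ))
        ≡⟨ ∑-isSub-size (suc (suc i)) (σ ∪ σ′) large Δ ⟩
      χ (size (σ ∪ σ′) ≡ᵇ suc (suc i)) * Δ (σ ∪ σ′)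
        ≡⟨ trans (sym (isFace*Δ (suc i) (σ ∪ σ′))) (sym (N≡ σ σ′)) ⟩
      N σ σ′
        ≡⟨ pad (N σ σ′) (codeg * Δ σ) ⟩
      N σ σ′ + 0ℚ * (codeg * Δ σ) ∎
      where
      open ≡-Reasoning
      rotate : ∀ a b c → a * (b * c) ≡ c * (a * b)
      rotate = solve-∀ ℚ-ring
      pad : ∀ a b → a ≡ a + 0ℚ * b
      pad = solve-∀ ℚ-ring
      large : suc (suc i) ℕ.≤ size (σ ∪ σ′)
      large with suc (suc i) ℕ.≤? size (σ ∪ σ′)
      ... | yes p = p
      ... | no ¬p = contradiction eq (true⇒¬false (subst (λ s → eqS σ s ≡ true) (trans σ≡ (sym σ′≡)) (eqS-refl σ)))
        where
        small : ∀ {ρ} → ρ ∈ V → size (σ ∪ σ′) ℕ.≤ size ρ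
        small ρ∈ = ℕₚ.≤-trans (ℕ.s≤s⁻¹ (ℕₚ.≰⇒> ¬p)) (ℕₚ.≤-reflexive (sym (∈faces⇒size {i} ρ∈)))
        σ≡ : σ ≡ σ ∪ σ′
        σ≡ = isSub-size-≡ σ (σ ∪ σ′) (isSub-∪ˡ σ σ′) (small σ∈)
        σ′≡ : σ′ ≡ σ ∪ σ′
        σ′≡ = isSub-size-≡ σ′ (σ ∪ σ′) (subst (λ s → isSub σ′ s ≡ true) (∪-comm σ′ σ) (isSub-∪ˡ σ′ σ)) (small σ′∈)

    -- The walk on V factors through the cofaces τ, up to a diagonal term.
    ∑-N : ∀ {σ} → σ ∈ V → ∀ (F : Subset n → ℚ) →
      ∑ V (λ σ′ → N σ σ′ * F σ′) ≡ ∑ E (λ τ → Δ τ * (χ (isSub σ τ) * ∑ V (λ σ′ → χ (isSub σ′ τ) * F σ′))) - codeg * Δ σ * F σ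
    ∑-N {σ} σ∈ F = begin
      ∑ V (λ σ′ → N σ σ′ * F σ′)
        ≡⟨ ∑-cong V (λ {σ′} σ′∈ → solveN (N σ σ′) (χ (eqS σ σ′)) (codeg * Δ σ) (F σ′) _ (common-cofaces σ∈ σ′∈)) ⟩
      ∑ V (λ σ′ → ∑ E (λ τ → Δ τ * (χ (isSub σ τ) * χ (isSub σ′ τ))) * F σ′ - χ (eqS σ σ′) * (codeg * Δ σ * F σ′))
        ≡⟨ ∑-- V _ _ ⟩
      ∑ V (λ σ′ → ∑ E (λ τ → Δ τ * (χ (isSub σ τ) * χ (isSub σ′ τ))) * F σ′) - ∑ V (λ σ′ → χ (eqS σ σ′) * (codeg * Δ σ * F σ′))
        ≡⟨ cong₂ _-_ exchange (∑-faces-eqS {i} σ∈ (λ σ′ → codeg * Δ σ * F σ′)) ⟩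
      ∑ E (λ τ → Δ τ * (χ (isSub σ τ) * ∑ V (λ σ′ → χ (isSub σ′ τ) * F σ′))) - codeg * Δ σ * F σ ∎
      where
      open ≡-Reasoning
      solveN : ∀ a e c f b → b ≡ a + e * c → a * f ≡ b * f - e * (c * f)
      solveN a e c f b refl = identity a e c f
        where
        identity : ∀ a e c f → a * f ≡ (a + e * c) * f - e * (c * f)
        identity = solve-∀ ℚ-ring
      assoc : ∀ a b c f → a * (b * c) * f ≡ a * (b * (c * f))
      assoc = solve-∀ ℚ-ring
      exchange : ∑ V (λ σ′ → ∑ E (λ τ → Δ τ * (χ (isSub σ τ) * χ (isSub σ′ τ))) * F σ′)
        ≡ ∑ E (λ τ → Δ τ * (χ (isSub σ τ) * ∑ V (λ σ′ → χ (isSub σ′ τ) * F σ′)))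
      exchange = trans (∑-cong V λ {σ′} _ → sym (∑-*ʳ E (F σ′) _)) (trans (∑-swap V E _) (∑-cong E λ {τ} _ →
        trans (∑-cong V λ {σ′} _ → assoc (Δ τ) (χ (isSub σ τ)) (χ (isSub σ′ τ)) (F σ′))
          (trans (∑-*ˡ V (Δ τ) _) (cong (Δ τ *_) (∑-*ˡ V (χ (isSub σ τ)) _)))))

    ∑∑-N : ∀ (F : Subset n → Subset n → ℚ) →
      ∑ V (λ σ → ∑ V (λ σ′ → N σ σ′ * F σ σ′))
        ≡ ∑ E (λ τ → Δ τ * ∑ V (λ σ → χ (isSub σ τ) * ∑ V (λ σ′ → χ (isSub σ′ τ) * F σ σ′))) - ∑ V (λ σ → codeg * Δ σ * F σ σ)
    ∑∑-N F = trans (∑-cong V λ {σ} σ∈ → ∑-N σ∈ (F σ)) (trans (∑-- V _ _) (cong (_- ∑ V (λ σ → codeg * Δ σ * F σ σ))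
      (trans (∑-swap V E _) (∑-cong E λ {τ} _ → ∑-*ˡ V (Δ τ) _))))

    open WeightedGraph V N 0≤N N-sym public

    -- Each coface of `σ` contains `i + 1` other `i`-faces. Hence the degree measure of the graph is
    -- proportional to `deg`, and volumes are multiples of cochain norms.
    D≡ : ∀ {σ} → σ ∈ V → D σ ≡ ι (suc i) * codeg * Δ σ
    D≡ {σ} σ∈ = begin
      D σ
        ≡⟨ ∑-cong V (λ _ → sym (*-identityʳ _)) ⟩
      ∑ V (λ σ′ → N σ σ′ * 1ℚ)
        ≡⟨ ∑-N σ∈ (λ _ → 1ℚ) ⟩
      ∑ E (λ τ → Δ τ * (χ (isSub σ τ) * ∑ V (λ σ′ → χ (isSub σ′ τ) * 1ℚ))) - codeg * Δ σ * 1ℚ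
        ≡⟨ cong (_- codeg * Δ σ * 1ℚ) (trans (∑-cong E λ {τ} τ∈ → trans
             (cong (λ q → Δ τ * (χ (isSub σ τ) * q)) (trans (∑-cong V λ _ → *-identityʳ _) (∑-subfaces τ∈)))
             (sym (*-assoc (Δ τ) (χ (isSub σ τ)) (ι (suc (suc i)))))) (trans (∑-*ʳ E (ι (suc (suc i))) _) (cong (_* ι (suc (suc i))) (∑-cofaces σ∈)))) ⟩
      codeg * Δ σ * (1ℚ + ι (suc i)) - codeg * Δ σ * 1ℚ
        ≡⟨ simplify codeg (Δ σ) (ι (suc i)) ⟩
      ι (suc i) * codeg * Δ σ ∎
      where
      open ≡-Reasoning
      simplify : ∀ c δ k → c * δ * (1ℚ + k) - c * δ * 1ℚ ≡ k * c * δ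
      simplify = solve-∀ ℚ-ring

    form-lower-bound : ∀ f → - normD f ≤ ι (suc i) * form f f
    form-lower-bound f = ≤-by-gap (ι (suc i) * ∑ E (λ τ → Δ τ * (S τ * S τ))) gap
      (0≤* (0≤ι (suc i)) (0≤∑ E λ {τ} _ → 0≤* (0≤Δ τ) (0≤p² (S τ))))
      where
      S : Subset n → ℚ
      S τ = ∑ V (λ σ → χ (isSub σ τ) * f σ)
      square : ∀ τ → ∑ V (λ σ → χ (isSub σ τ) * ∑ V (λ σ′ → χ (isSub σ′ τ) * (f σ * f σ′))) ≡ S τ * S τ
      square τ = trans (∑-cong V λ {σ} _ → trans (cong (χ (isSub σ τ) *_)
          (trans (∑-cong V λ {σ′} _ → left-comm (χ (isSub σ′ τ)) (f σ) (f σ′)) (∑-*ˡ V (f σ) _)))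
          (sym (*-assoc (χ (isSub σ τ)) (f σ) (S τ)))) (∑-*ʳ V (S τ) _)
        where
        left-comm : ∀ a b c → a * (b * c) ≡ b * (a * c)
        left-comm = solve-∀ ℚ-ring
      normD≡ : normD f ≡ ι (suc i) * ∑ V (λ σ → codeg * Δ σ * (f σ * f σ))
      normD≡ = trans (∑-cong V λ {σ} σ∈ → trans (cong (_* (f σ * f σ)) (D≡ σ∈)) (regroup (ι (suc i)) codeg (Δ σ) (f σ * f σ))) (∑-*ˡ V (ι (suc i)) _)
        where
        regroup : ∀ a b c e → a * b * c * e ≡ a * (b * c * e)
        regroup = solve-∀ ℚ-ring
      form≡ : form f f ≡ ∑ E (λ τ → Δ τ * (S τ * S τ)) - ∑ V (λ σ → codeg * Δ σ * (f σ * f σ))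
      form≡ = trans (∑∑-N (λ σ σ′ → f σ * f σ′)) (cong (_- ∑ V (λ σ → codeg * Δ σ * (f σ * f σ))) (∑-cong E λ {τ} _ → cong (Δ τ *_) (square τ)))
      gap : ι (suc i) * form f f - - normD f ≡ ι (suc i) * ∑ E (λ τ → Δ τ * (S τ * S τ))
      gap = trans (cong₂ (λ p q → ι (suc i) * p - - q) form≡ normD≡) (identity (ι (suc i)) _ _)
        where
        identity : ∀ k s c → k * (s - c) - - (k * c) ≡ k * s
        identity = solve-∀ ℚ-ring

    module _ (W : Subset n → Bool) where
      private
        a b : Subset n → ℚ
        a τ = ∑ V (λ σ → χ (isSub σ τ) * χ (W σ))
        b τ = ∑ V (λ σ → χ (isSub σ τ) * χ (not (W σ)))

      -- The absolute difference is 1 exactly when one face lies in `W` and the other outside, so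
      -- each `τ` counts its mixed pairs in both orders. The diagonal correction vanishes.
      variation≡ : variation (χ ∘ W) ≡ ∑ E (λ τ → Δ τ * (a τ * b τ + b τ * a τ))
      variation≡ = trans (∑∑-N (λ σ σ′ → ∣ χ (W σ) - χ (W σ′) ∣)) (trans
        (cong₂ _-_ (∑-cong E λ {τ} _ → cong (Δ τ *_) (factor τ)) (∑-zero V λ {σ} _ → trans (cong (λ q → codeg * Δ σ * ∣ q ∣) (+-inverseʳ (χ (W σ)))) (*-zeroʳ (codeg * Δ σ))))
        (drop _))
        where
        drop : ∀ p → p - 0ℚ ≡ p
        drop = solve-∀ ℚ-ring
        xor : ∀ p q → ∣ χ p - χ q ∣ ≡ χ p * χ (not q) + χ (not p) * χ q
        xor true  true  = refl
        xor true  false = refl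
        xor false true  = refl
        xor false false = refl
        expand : ∀ c p q r s → c * (p * q + r * s) ≡ p * (c * q) + r * (c * s)
        expand = solve-∀ ℚ-ring
        row : ∀ τ σ → χ (isSub σ τ) * ∑ V (λ σ′ → χ (isSub σ′ τ) * ∣ χ (W σ) - χ (W σ′) ∣)
          ≡ χ (isSub σ τ) * χ (W σ) * b τ + χ (isSub σ τ) * χ (not (W σ)) * a τ
        row τ σ = trans (cong (χ (isSub σ τ) *_) (trans (∑-cong V λ {σ′} _ → trans (cong (χ (isSub σ′ τ) *_) (xor (W σ) (W σ′)))
            (expand (χ (isSub σ′ τ)) (χ (W σ)) (χ (not (W σ′))) (χ (not (W σ))) (χ (W σ′))))
            (trans (∑-+ V _ _) (cong₂ _+_ (∑-*ˡ V (χ (W σ)) _) (∑-*ˡ V (χ (not (W σ))) _)))))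
          (distribute (χ (isSub σ τ)) (χ (W σ)) (b τ) (χ (not (W σ))) (a τ))
          where
          distribute : ∀ c p q r s → c * (p * q + r * s) ≡ c * p * q + c * r * s
          distribute = solve-∀ ℚ-ring
        factor : ∀ τ → ∑ V (λ σ → χ (isSub σ τ) * ∑ V (λ σ′ → χ (isSub σ′ τ) * ∣ χ (W σ) - χ (W σ′) ∣)) ≡ a τ * b τ + b τ * a τ
        factor τ = trans (∑-cong V λ {σ} _ → row τ σ) (trans (∑-+ V _ _) (cong₂ _+_ (∑-*ʳ V (b τ) _) (∑-*ʳ V (a τ) _)))

      0≤a : ∀ τ → 0ℚ ≤ a τ
      0≤a τ = 0≤∑ V λ {σ} _ → 0≤* (0≤χ (isSub σ τ)) (0≤χ (W σ))

      0≤b : ∀ τ → 0ℚ ≤ b τ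
      0≤b τ = 0≤∑ V λ {σ} _ → 0≤* (0≤χ (isSub σ τ)) (0≤χ (not (W σ)))

      a+b : ∀ {τ} → τ ∈ E → a τ + b τ ≡ ι (suc (suc i))
      a+b {τ} τ∈ = trans (sym (∑-+ V _ _)) (trans (∑-cong V λ {σ} _ → trans (sym (*-distribˡ-+ (χ (isSub σ τ)) (χ (W σ)) (χ (not (W σ)))))
        (trans (cong (χ (isSub σ τ) *_) (χ-not (W σ))) (*-identityʳ (χ (isSub σ τ))))) (∑-subfaces τ∈))

      any⇒1≤∑ : ∀ τ (U : Subset n → Bool) → any (λ σ → isSub σ τ ∧ U σ) V ≡ true → 1ℚ ≤ ∑ V (λ σ → χ (isSub σ τ) * χ (U σ))
      any⇒1≤∑ τ U e with any-sound (λ σ → isSub σ τ ∧ U σ) V e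
      ... | σ , σ∈ , p = subst (_≤ ∑ V (λ σ → χ (isSub σ τ) * χ (U σ))) (trans (sym (χ-∧ (isSub σ τ) (U σ))) (cong χ p))
        (∑-member V (λ {σ} _ → 0≤* (0≤χ (isSub σ τ)) (0≤χ (U σ))) σ∈)

      expanding : Subset n → Bool
      expanding τ = any (λ σ → isSub σ τ ∧ W σ) V ∧ any (λ σ → isSub σ τ ∧ not (W σ)) V

      cut-bound : ∀ {τ} → τ ∈ E → (ι (suc i) + ι (suc i)) * χ (expanding τ) ≤ a τ * b τ + b τ * a τ
      cut-bound {τ} τ∈ with expanding τ in eq
      ... | false = subst (_≤ a τ * b τ + b τ * a τ) (sym (*-zeroʳ (ι (suc i) + ι (suc i)))) (0≤+ (0≤* (0≤a τ) (0≤b τ)) (0≤* (0≤b τ) (0≤a τ)))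
      ... | true with ∧-true {any (λ σ → isSub σ τ ∧ W σ) V} eq
      ...   | eᵃ , eᵇ = ≤-by-gap _ (gap (a τ) (b τ) (ι (suc i)) (a+b τ∈)) (0≤+ 0≤prod 0≤prod)
        where
        0≤prod : 0ℚ ≤ (a τ - 1ℚ) * (b τ - 1ℚ)
        0≤prod = 0≤* (p≤q⇒0≤q-p (any⇒1≤∑ τ W eᵃ)) (p≤q⇒0≤q-p (any⇒1≤∑ τ (not ∘ W) eᵇ))
        gap : ∀ a b k → a + b ≡ 1ℚ + k → a * b + b * a - (k + k) * 1ℚ ≡ (a - 1ℚ) * (b - 1ℚ) + (a - 1ℚ) * (b - 1ℚ)
        gap a b k e = trans (cong (λ q → a * b + b * a - (q + q) * 1ℚ) k≡) (identity a b)
          where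
          peel : ∀ k → k ≡ 1ℚ + k - 1ℚ
          peel = solve-∀ ℚ-ring
          k≡ : k ≡ a + b - 1ℚ
          k≡ = trans (peel k) (cong (_- 1ℚ) (sym e))
          identity : ∀ a b → a * b + b * a - (a + b - 1ℚ + (a + b - 1ℚ)) * 1ℚ ≡ (a - 1ℚ) * (b - 1ℚ) + (a - 1ℚ) * (b - 1ℚ)
          identity = solve-∀ ℚ-ring

      ψ-variation : (ι (suc i) + ι (suc i)) * ι (degSum X (ψ X i W)) ≤ variation (χ ∘ W)
      ψ-variation = begin
        (ι (suc i) + ι (suc i)) * ι (degSum X (ψ X i W))
          ≡⟨ cong ((ι (suc i) + ι (suc i)) *_) (trans (ι-sum (deg X) (ψ X i W)) (∑-filterᵇ expanding E Δ)) ⟩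
        (ι (suc i) + ι (suc i)) * ∑ E (λ τ → χ (expanding τ) * Δ τ)
          ≡⟨ ∑-*ˡ E (ι (suc i) + ι (suc i)) _ ⟨
        ∑ E (λ τ → (ι (suc i) + ι (suc i)) * (χ (expanding τ) * Δ τ))
          ≡⟨ ∑-cong E (λ {τ} _ → rotate (ι (suc i) + ι (suc i)) (χ (expanding τ)) (Δ τ)) ⟩
        ∑ E (λ τ → Δ τ * ((ι (suc i) + ι (suc i)) * χ (expanding τ)))
          ≤⟨ ∑-mono E (λ {τ} τ∈ → *-monoˡ-≤ (Δ τ) (0≤Δ τ) (cut-bound τ∈)) ⟩
        ∑ E (λ τ → Δ τ * (a τ * b τ + b τ * a τ))
          ≡⟨ variation≡ ⟨
        variation (χ ∘ W) ∎
        where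
        open ≤-Reasoning
        rotate : ∀ a b c → a * (b * c) ≡ c * (a * b)
        rotate = solve-∀ ℚ-ring

-- Conductance from colorful expansion, and bounds on the constants.

module Expansion {n d : ℕ} (X : PureComplex n d) (1<d : 1 ℕ.< d)
  (ε : ℚ) (0<ε : 0ℚ < ε) (expander : ColorfulExpander X ε) where
  open Faces X

  h : ℕ → ℚ
  h i = ε * frac 1 (suc (suc i))

  0≤h : ∀ i → 0ℚ ≤ h i
  0≤h i = 0≤* (<⇒≤ 0<ε) (0≤frac1 (suc (suc i)))

  0<degSum : ∀ {k} → k ℕ.≤ d → 0 ℕ.< degSum X (faces X k)
  0<degSum {k} k≤d with ∃-face k≤d
  ... | s , s∈ = 0<ι⁻¹ (<-≤-trans (0<ι (0<deg {k} s∈))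
    (subst (Δ s ≤_) (sym (ι-sum (deg X) (faces X k))) (∑-member (faces X k) (λ {x} _ → 0≤Δ x) s∈)))

  module _ {i : ℕ} (i<d : i ℕ.< d) where
    open Dimension i

    0<codeg : 0ℚ < codeg
    0<codeg = p<q⇒0<q-p (<-≤-trans (subst (_< 1ℚ + ι i) (+-identityˡ (ι i)) (+-monoˡ-< (ι i) (positive⁻¹ 1ℚ))) (ι-mono i<d))

    0<D : ∀ {σ} → σ ∈ V → 0ℚ < D σ
    0<D {σ} σ∈ = subst (0ℚ <_) (sym (D≡ σ∈)) (0<* (0<* (0<ι {suc i} (ℕ.s≤s ℕ.z≤n)) 0<codeg) (0<ι (0<deg {i} σ∈)))

    vol≡ : ∀ W → vol W ≡ ι (suc i) * codeg * ι (degSum X (filterᵇ W V))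
    vol≡ W = trans (∑-cong V λ {σ} σ∈ → trans (cong (_* χ (W σ)) (D≡ σ∈)) (regroup (ι (suc i) * codeg) (Δ σ) (χ (W σ))))
      (trans (∑-*ˡ V (ι (suc i) * codeg) _) (cong (ι (suc i) * codeg *_) (sym (trans (ι-sum (deg X) (filterᵇ W V)) (∑-filterᵇ W V Δ)))))
      where
      regroup : ∀ a b c → a * b * c ≡ a * (c * b)
      regroup = solve-∀ ℚ-ring

    total≡ : total ≡ ι (suc i) * codeg * ι (degSum X V)
    total≡ = trans (∑-cong V D≡) (trans (∑-*ˡ V (ι (suc i) * codeg) Δ) (cong (ι (suc i) * codeg *_) (sym (ι-sum (deg X) V))))

    -- This is the expansion hypothesis with denominators cleared. The two norms have different
    -- denominators, and `degSum-ratio` exchanges them at the cost of `codeg / (i+2)`, the origin of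
    -- the `i + 2` in `h`.
    ψ-bound : ∀ W → 0 ℕ.< degSum X (filterᵇ W V) → ι (degSum X (filterᵇ W V)) ≤ ½ * ι (degSum X V) →
      h i * codeg * ι (degSum X (filterᵇ W V)) ≤ ι (degSum X (ψ X i W))
    ψ-bound W 0<w w≤½v = *-cancelˡ-≤ v (0<ι 0<v) (begin
      v * (ε * g * codeg * w)     ≡⟨ shuffle₁ v ε g codeg w ⟩
      ε * g * w * (codeg * v)     ≡⟨ cong (ε * g * w *_) degSum-ratio ⟨
      ε * g * w * (k * e)         ≡⟨ shuffle₂ ε g w k e ⟩
      (g * k) * (ε * w * e)       ≡⟨ cong (_* (ε * w * e)) g*k ⟩
      1ℚ * (ε * w * e)            ≡⟨ *-identityˡ (ε * w * e) ⟩
      ε * w * e                   ≡⟨ cong (λ q → ε * q * e) w≡ ⟩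
      ε * (ν * v) * e             ≡⟨ shuffle₃ ε ν v e ⟩
      v * e * (ε * ν)             ≤⟨ *-monoˡ-≤ (v * e) (0≤* (0≤ι (degSum X V)) (0≤ι (degSum X E))) (expander i i<d W 0<ν ν≤½) ⟩
      v * e * frac ψₙ eₙ          ≡⟨ shuffle₄ v e (frac ψₙ eₙ) ⟩
      v * (frac ψₙ eₙ * e)        ≡⟨ cong (v *_) (frac-*ι ψₙ (0<degSum i<d)) ⟩
      v * ι ψₙ                    ∎)
      where
      open ≤-Reasoning
      wₙ eₙ ψₙ : ℕ
      wₙ = degSum X (filterᵇ W V)
      eₙ = degSum X E
      ψₙ = degSum X (ψ X i W)
      v w e g k ν : ℚ
      v = ι (degSum X V)
      w = ι wₙ
      e = ι eₙ
      g = frac 1 (suc (suc i))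
      k = ι (suc (suc i))
      ν = norm X i W
      0<v : 0 ℕ.< degSum X V
      0<v = 0<degSum (ℕₚ.<⇒≤ i<d)
      g*k : g * k ≡ 1ℚ
      g*k = frac1-*ι {suc (suc i)} (ℕ.s≤s ℕ.z≤n)
      w≡ : w ≡ ν * v
      w≡ = sym (frac-*ι wₙ 0<v)
      0<ν : 0ℚ < ν
      0<ν = 0<frac 0<w 0<v
      ν≤½ : ν ≤ ½
      ν≤½ = *-cancelˡ-≤ v (0<ι 0<v) (subst₂ _≤_ (trans w≡ (*-comm ν v)) (*-comm ½ v) w≤½v)
      shuffle₁ : ∀ v ε g c w → v * (ε * g * c * w) ≡ ε * g * w * (c * v)
      shuffle₁ = solve-∀ ℚ-ring
      shuffle₂ : ∀ ε g w k e → ε * g * w * (k * e) ≡ (g * k) * (ε * w * e)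
      shuffle₂ = solve-∀ ℚ-ring
      shuffle₃ : ∀ ε ν v e → ε * (ν * v) * e ≡ v * e * (ε * ν)
      shuffle₃ = solve-∀ ℚ-ring
      shuffle₄ : ∀ v e p → v * e * p ≡ v * (p * e)
      shuffle₄ = solve-∀ ℚ-ring

    conductance : ∀ W → vol W ≤ ½ * total → (h i + h i) * vol W ≤ variation (χ ∘ W)
    conductance W small = byCases (degSum X (filterᵇ W V)) refl
      where
      c w : ℚ
      c = ι (suc i) * codeg
      w = ι (degSum X (filterᵇ W V))
      half : w ≤ ½ * ι (degSum X V)
      half = *-cancelˡ-≤ c (0<* (0<ι {suc i} (ℕ.s≤s ℕ.z≤n)) 0<codeg)
        (subst₂ _≤_ (vol≡ W) (trans (cong (½ *_) total≡) (left-comm ½ c (ι (degSum X V)))) small)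
        where
        left-comm : ∀ a b c → a * (b * c) ≡ b * (a * c)
        left-comm = solve-∀ ℚ-ring
      byCases : ∀ m → m ≡ degSum X (filterᵇ W V) → (h i + h i) * vol W ≤ variation (χ ∘ W)
      -- Expansion is assumed only for cochains of positive norm; a cochain of degree sum zero has
      -- volume zero and is settled directly.
      byCases zero eq = subst (_≤ variation (χ ∘ W))
        (sym (trans (cong ((h i + h i) *_) (trans (vol≡ W) (trans (cong (λ m → c * ι m) (sym eq)) (*-zeroʳ c)))) (*-zeroʳ (h i + h i))))
        (0≤∑∑ λ {x} {y} _ _ → 0≤∣p∣ (χ (W x) - χ (W y)))
      byCases (suc m) eq = begin
        (h i + h i) * vol W
          ≡⟨ cong ((h i + h i) *_) (vol≡ W) ⟩
        (h i + h i) * (ι (suc i) * codeg * w)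
          ≡⟨ regroup (h i) (ι (suc i)) codeg w ⟩
        (ι (suc i) + ι (suc i)) * (h i * codeg * w)
          ≤⟨ *-monoˡ-≤ (ι (suc i) + ι (suc i)) (0≤+ (0≤ι (suc i)) (0≤ι (suc i))) (ψ-bound W (subst (0 ℕ.<_) eq (ℕ.s≤s ℕ.z≤n)) half) ⟩
        (ι (suc i) + ι (suc i)) * ι (degSum X (ψ X i W))
          ≤⟨ ψ-variation W ⟩
        variation (χ ∘ W) ∎
        where
        open ≤-Reasoning
        regroup : ∀ h k c w → (h + h) * (k * c * w) ≡ (k + k) * (h * c * w)
        regroup = solve-∀ ℚ-ring

    open Cheeger (h i) (0≤h i) conductance public using (form≤)

    h≤1-from : ∀ W {σ} → σ ∈ V → W σ ≡ true → vol W ≤ ½ * total → h i ≤ 1ℚ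
    h≤1-from W {σ} σ∈ Wσ small = *-cancelˡ-≤ (vol W + vol W) (+-mono-< 0<vol 0<vol)
      (subst₂ _≤_ (swap (h i) (vol W)) (sym (*-identityʳ (vol W + vol W))) (≤-trans (conductance W small) (variation-χ≤2vol W)))
      where
      swap : ∀ h v → (h + h) * v ≡ (v + v) * h
      swap = solve-∀ ℚ-ring
      0<vol : 0ℚ < vol W
      0<vol = <-≤-trans (subst (0ℚ <_) (sym (trans (cong (λ b → D σ * χ b) Wσ) (*-identityʳ (D σ)))) (0<D σ∈))
        (∑-member V (λ {x} _ → 0≤* (0≤D x) (0≤χ (W x))) σ∈)

  0<d : 0 ℕ.< d
  0<d = ℕₚ.<⇒≤ 1<d

  -- A facet has at least two vertices, so some set of vertices and its complement both have
  -- positive volume; the lighter of the two has at most half and is admissible in `h≤1-from`.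
  h₀≤1 : h 0 ≤ 1ℚ
  h₀≤1 with ∃-facet
  ... | f , f∈ , |f| with split-vertices f (ℕₚ.≤-trans (ℕₚ.m≤n⇒m≤1+n 1<d) (ℕₚ.≤-reflexive (sym |f|)))
  ...   | W , σ , σ′ , (σ⊆f , |σ| , Wσ) , (σ′⊆f , |σ′| , Wσ′) = choose (≤-total (vol W) (vol (not ∘ W)))
    where
    open Dimension 0
    vols : vol W + vol (not ∘ W) ≡ total
    vols = trans (sym (∑-+ V _ _)) (∑-cong V λ {x} _ → trans (sym (*-distribˡ-+ (D x) (χ (W x)) (χ (not (W x)))))
      (trans (cong (D x *_) (χ-not (W x))) (*-identityʳ (D x))))
    half : ∀ {p q t} → p + q ≡ t → p ≤ q → p ≤ ½ * t
    half {p} {q} refl p≤q = ≤-by-gap _ (gap p q) (0≤* 0≤½ (p≤q⇒0≤q-p p≤q))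
      where
      gap : ∀ p q → ½ * (p + q) - p ≡ ½ * (q - p)
      gap = solve-∀ ℚ-ring
    choose : vol W ≤ vol (not ∘ W) ⊎ vol (not ∘ W) ≤ vol W → h 0 ≤ 1ℚ
    choose (inj₁ le) = h≤1-from 0<d W (⊆facet⇒∈faces f∈ σ⊆f |σ|) Wσ (half vols le)
    choose (inj₂ le) = h≤1-from 0<d (not ∘ W) (⊆facet⇒∈faces f∈ σ′⊆f |σ′|) (cong not Wσ′)
      (half (trans (+-comm (vol (not ∘ W)) (vol W)) vols) le)

  δ : ℚ
  δ = frac 1 (2 ℕ.* (suc d ℕ.* suc d))

  μ : ℚ
  μ = muBound d ε

  2[d+1]²>0 : 0 ℕ.< 2 ℕ.* (suc d ℕ.* suc d)
  2[d+1]²>0 = ℕ.s≤s ℕ.z≤n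

  0<δ : 0ℚ < δ
  0<δ = 0<frac1 2[d+1]²>0

  0≤ε² : 0ℚ ≤ ε * ε
  0≤ε² = 0≤p² ε

  ε≡2h₀ : ε ≡ h 0 + h 0
  -- `frac 1 2` evaluates to `½`.
  ε≡2h₀ = halves ε
    where
    halves : ∀ e → e ≡ e * ½ + e * ½
    halves = solve-∀ ℚ-ring

  ε²≤4 : ε * ε ≤ ι 4
  ε²≤4 = subst (λ e → e * e ≤ ι 4) (sym ε≡2h₀) (≤-by-gap _ (gap (h 0)) (0≤* (0≤ι 4) (0≤* (0≤+ 0≤1 (0≤h 0)) (p≤q⇒0≤q-p h₀≤1))))
    where
    gap : ∀ h → ι 4 - (h + h) * (h + h) ≡ ι 4 * ((1ℚ + h) * (1ℚ - h))
    gap = solve-∀ ℚ-ring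

  δ≤1/16 : δ ≤ frac 1 16
  -- For `d ≥ 2` the denominator `2(d+1)²` is at least 18. The number 16 is what the lazy walk
  -- requires: half of `½ (ε/2)²` is `ε²/16`.
  δ≤1/16 = frac1-anti (ℕ.s≤s ℕ.z≤n) (ℕₚ.≤-trans (toWitness {a? = 16 ℕ.≤? 18} tt) (ℕₚ.*-monoʳ-≤ 2 (ℕₚ.*-mono-≤ (ℕ.s≤s 1<d) (ℕ.s≤s 1<d))))

  ε²δ≤½ : ε * ε * δ ≤ ½
  ε²δ≤½ = ≤-trans (*-monoˡ-≤ (ε * ε) 0≤ε² δ≤1/16) (≤-trans (*-monoʳ-≤-nonNeg (frac 1 16) ε²≤4) (toWitness {a? = ι 4 * frac 1 16 ≤? ½} tt))

  ½≤μ : ½ ≤ μ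
  ½≤μ = ≤-by-gap _ (gap (ε * ε * δ)) (p≤q⇒0≤q-p ε²δ≤½)
    where
    gap : ∀ a → 1ℚ - a - ½ ≡ ½ - a
    gap = solve-∀ ℚ-ring

  0<μ : 0ℚ < μ
  0<μ = <-≤-trans (positive⁻¹ ½) ½≤μ

  μ<1 : μ < 1ℚ
  μ<1 = subst (μ <_) (+-identityʳ 1ℚ) (+-monoʳ-< 1ℚ (neg-antimono-< (0<* (0<* 0<ε 0<ε) 0<δ)))

  -- Since `h i` is `ε / (i+2)`, the claim amounts to `i + 2 ≤ d + 1`, with equality in the top
  -- dimension `i = d - 1`.
  ε²δ≤½h² : ∀ {i} → i ℕ.< d → ε * ε * δ ≤ ½ * (h i * h i)
  ε²δ≤½h² {i} i<d = begin
    ε * ε * δ                                 ≡⟨ pad (ε * ε * δ) ⟩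
    1ℚ * 1ℚ * (ε * ε * δ)                     ≡⟨ cong (λ q → q * q * (ε * ε * δ)) (frac1-*ι {suc (suc i)} (ℕ.s≤s ℕ.z≤n)) ⟨
    g * k * (g * k) * (ε * ε * δ)             ≡⟨ shuffle g k ε δ ⟩
    h i * h i * (δ * (k * k))                 ≤⟨ *-monoˡ-≤ (h i * h i) (0≤p² (h i)) (*-monoˡ-≤ δ (<⇒≤ 0<δ) k²≤K²) ⟩
    h i * h i * (δ * (K * K))                 ≡⟨ cong (h i * h i *_) δK² ⟩
    h i * h i * ½                             ≡⟨ *-comm (h i * h i) ½ ⟩
    ½ * (h i * h i)                           ∎
    where
    open ≤-Reasoning
    g k K : ℚ
    g = frac 1 (suc (suc i))
    k = ι (suc (suc i))
    K = ι (suc d)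
    pad : ∀ a → a ≡ 1ℚ * 1ℚ * a
    pad = solve-∀ ℚ-ring
    shuffle : ∀ g k ε δ → g * k * (g * k) * (ε * ε * δ) ≡ ε * g * (ε * g) * (δ * (k * k))
    shuffle = solve-∀ ℚ-ring
    k²≤K² : k * k ≤ K * K
    k²≤K² = subst₂ _≤_ (ι-* (suc (suc i)) (suc (suc i))) (ι-* (suc d) (suc d)) (ι-mono (ℕₚ.*-mono-≤ (ℕ.s≤s i<d) (ℕ.s≤s i<d)))
    δK² : δ * (K * K) ≡ ½
    δK² = trans (halve δ (K * K)) (trans (cong (λ q → ½ * (δ * q)) (sym (trans (ι-* 2 (suc d ℕ.* suc d)) (cong (ι 2 *_) (ι-* (suc d) (suc d))))))
      (trans (cong (½ *_) (frac1-*ι 2[d+1]²>0)) (*-identityʳ ½)))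
      where
      halve : ∀ δ q → δ * q ≡ ½ * (δ * (ι 2 * q))
      halve = solve-∀ ℚ-ring

-- The form bounds for each `G_i`, lazy for `i = 0`, and the mixing theorem.

module Walk {n d : ℕ} (X : PureComplex n d) (1<d : 1 ℕ.< d)
  (ε : ℚ) (0<ε : 0ℚ < ε) (expander : ColorfulExpander X ε) where
  open Faces X
  open Expansion X 1<d ε 0<ε expander

  gW-sym : ∀ i σ σ′ → gW X i σ σ′ ≡ gW X i σ′ σ
  gW-sym zero σ σ′ = cong₂ ℕ._+_ (nbrW-sym zero σ σ′) loops
    where
    nbrW-sym : ∀ i σ σ′ → nbrW X i σ σ′ ≡ nbrW X i σ′ σ
    nbrW-sym i σ σ′ = cong (λ s → if isFace X (suc i) s then deg X s else 0) (∪-comm σ σ′)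
    loops : (if eqS σ σ′ then nbrDeg X zero σ else 0) ≡ (if eqS σ′ σ then nbrDeg X zero σ′ else 0)
    loops with eqS σ σ′ in eq
    ... | true rewrite eqS-sound σ σ′ eq | eqS-refl σ′ = refl
    ... | false rewrite trans (sym (eqS-sym σ σ′)) eq = refl
  gW-sym (suc i) σ σ′ = cong (λ s → if isFace X (suc (suc i)) s then deg X s else 0) (∪-comm σ σ′)

  module G (i : ℕ) = WeightedGraph (faces X i) (λ σ σ′ → ι (gW X i σ σ′))
    (λ σ σ′ → 0≤ι (gW X i σ σ′)) (λ σ σ′ → cong ι (gW-sym i σ σ′))

  D≡ι : ∀ i σ → G.D i σ ≡ ι (gDeg X i σ)
  D≡ι i σ = sym (ι-sum (gW X i σ) (faces X i))

  module Lazy where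
    private
      module L = Dimension 0
      module G₀ = G 0

    row : ∀ {σ} → σ ∈ L.V → ∀ (F : Subset n → ℚ) →
      ∑ L.V (λ σ′ → ι (gW X 0 σ σ′) * F σ′) ≡ ∑ L.V (λ σ′ → L.N σ σ′ * F σ′) + L.D σ * F σ
    row {σ} σ∈ F = trans (∑-cong L.V λ {σ′} _ → trans (cong (_* F σ′) (trans (ι-+ (nbrW X 0 σ σ′) _) (cong (L.N σ σ′ +_) (loop (eqS σ σ′)))))
        (expand (L.N σ σ′) (χ (eqS σ σ′)) (L.D σ) (F σ′)))
      (trans (∑-+ L.V _ _) (cong (∑ L.V (λ σ′ → L.N σ σ′ * F σ′) +_) (∑-faces-eqS {0} σ∈ (λ σ′ → L.D σ * F σ′))))
      where
      loop : ∀ b → ι (if b then nbrDeg X 0 σ else 0) ≡ χ b * L.D σ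
      loop true  = trans (ι-sum (nbrW X 0 σ) L.V) (sym (*-identityˡ (L.D σ)))
      loop false = sym (*-zeroˡ (L.D σ))
      expand : ∀ a e d f → (a + e * d) * f ≡ a * f + e * (d * f)
      expand = solve-∀ ℚ-ring

    D≡2D : ∀ {σ} → σ ∈ L.V → G₀.D σ ≡ L.D σ + L.D σ
    D≡2D {σ} σ∈ = trans (∑-cong L.V λ _ → sym (*-identityʳ _)) (trans (row σ∈ (λ _ → 1ℚ))
      (cong₂ _+_ (∑-cong L.V λ _ → *-identityʳ _) (*-identityʳ (L.D σ))))

    form≡ : ∀ f → G₀.form f f ≡ L.form f f + L.normD f
    form≡ f = trans (∑-cong L.V λ {σ} σ∈ → row σ∈ (λ σ′ → f σ * f σ′)) (∑-+ L.V _ _)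

    ∑D≡ : ∀ (g : Subset n → ℚ) → ∑ L.V (λ σ → G₀.D σ * g σ) ≡ ∑ L.V (λ σ → L.D σ * g σ) + ∑ L.V (λ σ → L.D σ * g σ)
    ∑D≡ g = trans (∑-cong L.V λ {σ} σ∈ → trans (cong (_* g σ) (D≡2D σ∈)) (*-distribʳ-+ (g σ) (L.D σ) (L.D σ))) (∑-+ L.V _ _)

    upper : ∀ f → ∑ L.V (λ σ → G₀.D σ * f σ) ≡ 0ℚ → G₀.form f f ≤ μ * G₀.normD f
    upper f f⊥1 = subst₂ _≤_ (sym (form≡ f)) (cong (μ *_) (sym (∑D≡ (λ σ → f σ * f σ))))
      -- The loops double the degrees and add `normD` to the form. With `ε = 2 h 0` the required
      -- inequality is the Cheeger bound of the walk without loops plus `8 h² (1/16 - δ)` times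
      -- `normD`: the term `8 h² / 16` compensates the `½ h²` lost in the Cheeger bound.
      (≤-by-gap _ (gap (h 0) δ (L.form f f) (L.normD f) ε ε≡2h₀)
        (0≤+ (p≤q⇒0≤q-p (form≤ 0<d f f⊥1′)) (0≤* (0≤* (0≤* (0≤ι 8) (0≤p² (h 0))) (p≤q⇒0≤q-p δ≤1/16)) 0≤normD)))
      where
      0≤normD : 0ℚ ≤ L.normD f
      0≤normD = 0≤∑ L.V λ {x} _ → 0≤* (L.0≤D x) (0≤p² (f x))
      f⊥1′ : ∑ L.V (λ σ → L.D σ * f σ) ≡ 0ℚ
      f⊥1′ = trans (halves _) (trans (cong (½ *_) (trans (sym (∑D≡ f)) f⊥1)) (*-zeroʳ ½))
        where
        halves : ∀ p → p ≡ ½ * (p + p)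
        halves = solve-∀ ℚ-ring
      gap : ∀ h δ q s e → e ≡ h + h → (1ℚ - e * e * δ) * (s + s) - (q + s)
        ≡ (1ℚ - ½ * (h * h)) * s - q + ι 8 * (h * h) * (frac 1 16 - δ) * s
      gap h δ q s _ refl = identity h δ q s
        where
        identity : ∀ h δ q s → (1ℚ - (h + h) * (h + h) * δ) * (s + s) - (q + s)
          ≡ (1ℚ - ½ * (h * h)) * s - q + ι 8 * (h * h) * (frac 1 16 - δ) * s
        identity = solve-∀ ℚ-ring

    lower : ∀ f → - (μ * G₀.normD f) ≤ G₀.form f f
    lower f = ≤-trans (neg-antimono-≤ (0≤* (<⇒≤ 0<μ) (0≤∑ L.V λ {x} _ → 0≤* (G₀.0≤D x) (0≤p² (f x)))))
      (subst (0ℚ ≤_) (trans (collect (L.form f f) (L.normD f)) (sym (form≡ f))) (p≤q⇒0≤q-p (L.form-lower-bound f)))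
      where
      collect : ∀ q s → ι 1 * q - - s ≡ q + s
      collect = solve-∀ ℚ-ring

  form-upper : ∀ {i} → i ℕ.< d → ∀ f → ∑ (faces X i) (λ σ → G.D i σ * f σ) ≡ 0ℚ → G.form i f f ≤ μ * G.normD i f
  form-upper {zero}  _   f f⊥1 = Lazy.upper f f⊥1
  form-upper {suc i} i<d f f⊥1 = ≤-trans (form≤ i<d f f⊥1) (≤-by-gap _
    (gap (ε * ε * δ) (½ * (h (suc i) * h (suc i))) (L.normD f))
    (0≤* (p≤q⇒0≤q-p (ε²δ≤½h² i<d)) (0≤∑ L.V λ {x} _ → 0≤* (L.0≤D x) (0≤p² (f x)))))
    where
    module L = Dimension (suc i)
    gap : ∀ a b s → (1ℚ - a) * s - (1ℚ - b) * s ≡ (b - a) * s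
    gap = solve-∀ ℚ-ring

  form-lower : ∀ i f → - (μ * G.normD i f) ≤ G.form i f f
  form-lower zero    f = Lazy.lower f
  form-lower (suc i) f = *-cancelˡ-≤ k (0<ι {suc (suc i)} (ℕ.s≤s ℕ.z≤n)) (≤-trans
    (≤-by-gap _ (gap k μ (L.normD f)) (0≤* (p≤q⇒0≤q-p 1≤kμ) (0≤∑ L.V λ {x} _ → 0≤* (L.0≤D x) (0≤p² (f x)))))
    (L.form-lower-bound f))
    where
    module L = Dimension (suc i)
    k : ℚ
    k = ι (suc (suc i))
    gap : ∀ k μ s → - s - k * - (μ * s) ≡ (k * μ - 1ℚ) * s
    gap = solve-∀ ℚ-ring
    1≤kμ : 1ℚ ≤ k * μ
    -- The dimension here is `suc i ≥ 1`, so the factor `k` is at least 2 and balances `½ ≤ μ`.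
    1≤kμ = ≤-trans (*-monoˡ-≤ (ι 2) (0≤ι 2) ½≤μ) (*-monoʳ-≤-nonNeg μ {{nonNegative (<⇒≤ 0<μ)}} (ι-mono {2} {suc (suc i)} (ℕ.s≤s (ℕ.s≤s ℕ.z≤n))))

  0<gDeg : ∀ {i} → i ℕ.< d → ∀ {σ} → σ ∈ faces X i → 0 ℕ.< gDeg X i σ
  0<gDeg {zero} 0<d {σ} σ∈ = 0<ι⁻¹ (subst (0ℚ <_) (trans (sym (Lazy.D≡2D σ∈)) (D≡ι 0 σ)) (+-mono-< (0<D 0<d σ∈) (0<D 0<d σ∈)))
  0<gDeg {suc i} i<d {σ} σ∈ = 0<ι⁻¹ (subst (0ℚ <_) (D≡ι (suc i) σ) (0<D i<d σ∈))

  rapidlyMixing : ∀ i → i ℕ.< d → RapidlyMixing X i μ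
  rapidlyMixing i i<d = 0<μ , μ<1 , λ { π₀ (0≤π₀ , ∑π₀) t → mixing π₀ (All.lookup 0≤π₀) ∑π₀ t }
    where
    V : List (Subset n)
    V = faces X i
    r : Subset n → ℚ
    r σ = frac 1 (gDeg X i σ)
    vol : ℕ
    vol = sum (map (gDeg X i) V)
    total≡ιvol : G.total i ≡ ι vol
    total≡ιvol = trans (∑-cong V λ {σ} _ → D≡ι i σ) (sym (ι-sum (gDeg X i) V))
    face : ∃ λ σ → σ ∈ V
    face = ∃-face (ℕₚ.<⇒≤ i<d)
    0<vol : 0 ℕ.< vol
    0<vol = 0<ι⁻¹ (<-≤-trans (0<ι (0<gDeg i<d (proj₂ face)))
      (subst (ι (gDeg X i (proj₁ face)) ≤_) (sym (ι-sum (gDeg X i) V)) (∑-member V (λ {σ} _ → 0≤ι (gDeg X i σ)) (proj₂ face))))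
    0<dmin : 0 ℕ.< dmin X i
    0<dmin = 0<minL (gDeg X i) (proj₂ face) (0<gDeg i<d)

    mixing : ∀ π₀ → (∀ {σ} → σ ∈ V → 0ℚ ≤ π₀ σ) → ∑ V π₀ ≡ 1ℚ → ∀ t →
      dist² X i (walk X i π₀ t) (stationary X i) ≤ frac (dmax X i) (dmin X i) * ((μ ^ℚ t) * (μ ^ℚ t))
    mixing π₀ 0≤π₀ ∑π₀ t = subst₂ (λ p q → p ≤ q * ((μ ^ℚ t) * (μ ^ℚ t)))
      (∑-cong V λ {σ} _ → cong (λ p → (walk X i π₀ t σ - p) * (walk X i π₀ t σ - p)) (stationary≡ σ))
      (sym (frac≡ι*frac1 (dmax X i) (dmin X i)))
      (R.ℓ²-mixing (frac 1 vol) (trans (cong (frac 1 vol *_) total≡ιvol) (frac1-*ι 0<vol))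
        π₀ 0≤π₀ ∑π₀ (walk X i π₀) (λ _ → refl)
        (λ t σ → ∑-cong V λ {ρ} _ → cong (walk X i π₀ t ρ *_) (frac≡ι*frac1 (gW X i ρ σ) (gDeg X i ρ)))
        (ι (dmax X i)) (frac 1 (dmin X i)) (0≤ι (dmax X i))
        (λ {σ} σ∈ → subst (_≤ ι (dmax X i)) (sym (D≡ι i σ)) (ι-mono (maxL-upper (gDeg X i) σ∈)))
        (0≤frac1 (dmin X i))
        (λ σ∈ → frac1-anti 0<dmin (minL-lower (gDeg X i) σ∈)) t)
      where
      module R = G.RandomWalk i r (λ σ → 0≤frac1 (gDeg X i σ))
        (λ {σ} σ∈ → trans (cong (_* r σ) (D≡ι i σ)) (trans (*-comm (ι (gDeg X i σ)) (r σ)) (frac1-*ι (0<gDeg i<d σ∈))))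
        μ 0<μ (form-upper i<d) (λ f _ → form-lower i f)
      stationary≡ : ∀ σ → frac 1 vol * G.D i σ ≡ stationary X i σ
      stationary≡ σ = trans (cong (frac 1 vol *_) (D≡ι i σ)) (trans (*-comm (frac 1 vol) (ι (gDeg X i σ))) (sym (frac≡ι*frac1 (gDeg X i σ) vol)))

theorem3p1 : ∀ {n d : ℕ} (X : PureComplex n d) → 1 ℕ.< d →
    (ε : ℚ) → 0ℚ Data.Rational.< ε → ColorfulExpander X ε →
    ∀ (i : ℕ) → i ℕ.< d → RapidlyMixing X i (muBound d ε)
theorem3p1 X 1<d ε 0<ε expander = Walk.rapidlyMixing X 1<d ε 0<ε expander
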